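{- Let $G=\hat{K}_{2,4}^{(3)}$. The Strong Ramsey game $\mathcal{R}(K_{\aleph_0}^{(3)}, G)$ is a draw, i.e. $P_1$ has no winning strategy; equivalently, $P_2$ has a strategy guaranteeing that $P_1$ never completes a monochromatic copy of $G$ in her color before $P_2$ completes one in his.
   Context: Strong Ramsey game $\mathcal{R}(B,G)$: $B$ (the board) and $G$ (the target graph) are $k$-uniform hypergraphs, $G$ finite, $B$ possibly infinite. Two players $P_1$ and $P_2$ alternately color previously uncolored edges of $B$ in their own color, $P_1$ moving first. Whoever first completes a monochromatic copy of $G$ in their own color wins; if no one does so in finitely many moves, the game is a draw. The game "is a draw" means neither player has a winning strategy. $K_{\aleph_0}^{(3)}$ denotes the complete $3$-uniform hypergraph on a countably infinite vertex set. For $l\ge 3$, $\hat{K}_{2,l}$ is the graph obtained from the complete bipartite graph $K_{2,l}$ by adding the edge joining its two vertices of degree $l$. For a graph $H$, $H^{(k)}$ is the $k$-uniform hypergraph obtained by adding the same fixed set of $k-2$ new vertices to every edge of $H$. Thus $\hat{K}_{2,4}^{(3)}$ has vertices $c,x,y,u_1,\dots,u_4$ and the $9$ edges $cxy$, $cxu_i$, $cyu_i$ ($i\in[4]$). -}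

module Defs where

open import Data.Nat using (ℕ; zero; suc; _<_)
open import Data.Bool using (Bool; true; false; not)
open import Data.Fin using (Fin; #_)
open import Data.Product using (Σ; _×_; _,_)
open import Data.Sum using (_⊎_)
open import Data.List using (List; []; _∷_; _++_; [_]; length)
open import Data.List.Membership.Propositional using (_∈_)
open import Data.List.Relation.Unary.All using (All)
open import Data.List.Relation.Unary.Any using (Any)
open import Relation.Binary.PropositionalEquality using (_≡_)
open import Relation.Nullary using (¬_)
open import Function.Bundles using (_⇔_)
open import Function.Definitions using (Injective)

-- The board K_{ℵ₀}^{(3)}: vertex set ℕ, edges = 3-element subsets of ℕ.
-- An edge is represented canonically as a strictly increasing triple.

Triple : Set
Triple = ℕ × ℕ × ℕ

BoardEdge : Triple → Set
BoardEdge (x , y , z) = (x < y) × (y < z)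

_∈ᵛ_ : ℕ → Triple → Set
v ∈ᵛ (x , y , z) = (v ≡ x) ⊎ (v ≡ y) ⊎ (v ≡ z)

SameEdge : Triple → Triple → Set
SameEdge e f = ∀ v → (v ∈ᵛ e) ⇔ (v ∈ᵛ f)

HasEdge : List Triple → Triple → Set
HasEdge S t = Any (SameEdge t) S

-- The target G = \hat{K}_{2,4}^{(3)}
-- vertices: 0 = c, 1 = x, 2 = y, 3..6 = u₁..u₄
-- edges: cxy, cxuᵢ, cyuᵢ (9 edges)

FTriple : Set
FTriple = Fin 7 × Fin 7 × Fin 7

Gedges : List FTriple
Gedges =
  (# 0 , # 1 , # 2) ∷
  (# 0 , # 1 , # 3) ∷ (# 0 , # 1 , # 4) ∷ (# 0 , # 1 , # 5) ∷ (# 0 , # 1 , # 6) ∷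
  (# 0 , # 2 , # 3) ∷ (# 0 , # 2 , # 4) ∷ (# 0 , # 2 , # 5) ∷ (# 0 , # 2 , # 6) ∷ []

mapT : (Fin 7 → ℕ) → FTriple → Triple
mapT φ (a , b , c) = (φ a , φ b , φ c)

HasCopyG : List Triple → Set
HasCopyG S = Σ (Fin 7 → ℕ) λ φ →
  Injective _≡_ _≡_ φ × All (λ t → HasEdge S (mapT φ t)) Gedges

-- The game. A history is the list of edges colored so far, in order;
-- moves at even positions (0,2,4,…) are P₁'s, odd positions are P₂'s.

History : Set
History = List Triple

Strategy : Set
Strategy = History → Triple

Legal : History → Triple → Set
Legal h e = BoardEdge e × ¬ (e ∈ h)

isEven : ℕ → Bool
isEven zero = true
isEven (suc n) = not (isEven n)

evens odds : History → List Triple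
evens [] = []
evens (e ∷ h) = e ∷ odds h
odds [] = []
odds (e ∷ h) = evens h

mover : Strategy → Strategy → ℕ → Strategy
mover σ₁ σ₂ n with isEven n
... | true = σ₁
... | false = σ₂

play : Strategy → Strategy → ℕ → History
play σ₁ σ₂ zero = []
play σ₁ σ₂ (suc n) = play σ₁ σ₂ n ++ [ mover σ₁ σ₂ n (play σ₁ σ₂ n) ]

-- σ₁ is a winning strategy for P₁ in R(K_{ℵ₀}^{(3)}, G):
-- against every legal strategy of P₂ there is a finite time n such that
-- all of P₁'s moves before time n were legal, P₁'s edges after n moves
-- contain a copy of G and P₂'s edges do not (so, by monotonicity,
-- P₁ completed a copy first).
P₁Wins : Strategy → Set
P₁Wins σ₁ = ∀ (σ₂ : Strategy) → (∀ h → Legal h (σ₂ h)) →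
  Σ ℕ λ n →
    (∀ k → k < n → isEven k ≡ true → Legal (play σ₁ σ₂ k) (σ₁ (play σ₁ σ₂ k)))
    × HasCopyG (evens (play σ₁ σ₂ n))
    × ¬ HasCopyG (odds (play σ₁ σ₂ n))

{-# OPTIONS --safe #-}

-- A core is G without one of its four pages: the edges cxy, cxu and cyu for three vertices u. A player who owns a core and is
-- to move can threaten forever by cyv with v new; the forced answer cxv has a vertex of degree one, so it hardly helps the
-- opponent. Hence P₂ only needs a core in time. He builds it on vertices outside the first edge e of P₁. A block of P₁ is
-- then disjoint from e and, as all edges of a copy of G share the centre, either e or the block is wasted for her. So when
-- P₂ completes his core, after 7 moves, 8 moves with one block or 9 moves with two blocks, P₁ threatens at most one copy of
-- G, with centre κ and spine κpq say, and nearly all her edges lie in it. From then on her only threats are κpw and κqw, each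
-- answered by the other, and as soon as she makes no threat P₂ starts his own endless threats.

module Submission where

open import Defs
open import Data.Bool using (true)
open import Data.Empty using (⊥; ⊥-elim)
open import Data.List using (List; []; _∷_; _++_; length; map; [_])
import Data.List.Membership.DecPropositional as DecMembership
open import Data.List.Membership.Propositional using (_∈_; find)
open import Data.List.Membership.Propositional.Properties using (∈-++⁺ˡ; ∈-++⁺ʳ; ∈-++⁻)
open import Data.List.Properties using (length-++; length-map; ++-assoc)
open import Data.List.Relation.Unary.All as All using (All; []; _∷_)
import Data.List.Relation.Unary.All.Properties as Allₚ
open import Data.List.Relation.Unary.AllPairs as AllPairs using (AllPairs; []; _∷_)
import Data.List.Relation.Unary.AllPairs.Properties as AllPairsₚ
open import Data.List.Relation.Unary.Any as Any using (Any; here; there)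
import Data.List.Relation.Unary.Any.Properties as Anyₚ
open import Data.List.Relation.Unary.Unique.Propositional using (Unique)
open import Data.Nat using (ℕ; zero; suc; _+_; _≤_; _<_; z≤n; s≤s; _⊔_; ⌊_/2⌋)
open import Data.Nat.Properties using (_≟_; ≤-trans; ≤-refl; ≤-reflexive; <⇒≢; <⇒≤; <-trans; <-irrefl; ≤-antisym; <-cmp; ≤-pred; _<?_; n<1+n; m<n⇒m<1+n; m≤m⊔n; m≤n⊔m; +-comm; +-identityʳ; +-monoʳ-≤; +-cancelˡ-≤; +-suc; +-mono-≤; 1+n≰n; suc-injective; m≤n+m; n≤1+n)
open import Data.Product using (Σ; _×_; _,_; proj₁; proj₂; swap)
open import Data.Product.Properties using (≡-dec)
open import Data.Sum using (_⊎_; inj₁; inj₂; [_,_]′)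
import Data.Vec as Vec
import Data.Vec.Relation.Unary.All as VecAll
import Data.Vec.Relation.Unary.AllPairs as VecAllPairs
open import Data.Vec.Relation.Unary.Unique.Propositional.Properties using (lookup-injective)
open import Function using (_∘_; id)
open import Function.Bundles using (mk⇔; module Equivalence)
open import Relation.Binary.Definitions using (tri<; tri≈; tri>)
open import Relation.Binary.PropositionalEquality using (_≡_; _≢_; refl; sym; trans; cong; subst; ≢-sym; cong₂; module ≡-Reasoning)
open import Relation.Nullary using (¬_; Dec; yes; no)
open import Relation.Nullary.Decidable using (map′; _×-dec_; _⊎-dec_; toSum; ¬?)

-- The constants 7, 8 and 9 come from one count. After her reply to a core finished in 7 + k moves,
-- P₁ owns at most 8 + k edges. If every copy of G misses at least k of them, at most eight remain
-- for it: too few for the nine edges of G, and a copy lacking a single edge must use all eight. So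
-- each delay of the core has to be paid for by a wasted edge of hers. Later stages are controlled
-- by pair degrees. In a copy, the centre together with either spine vertex is a pair lying in five
-- edges; a copy that is two edges away therefore needs two pairs of degree at least three through a
-- common centre. `Frame` leaves κp and κq as the only candidates, so P₁ cannot switch to another
-- copy while P₂ follows the pairing. The forced answers of a chase all contain one pair, and they
-- help P₁ only if she already owns a core on that pair. P₂ can choose whether it is cx or cy, hence
-- she would need cores on both.

pattern 1st = inj₁ refl
pattern 2nd = inj₂ (inj₁ refl)
pattern 3rd = inj₂ (inj₂ refl)

-- Edges as vertex sets

infix 4 _≈_ _∈ₑ_ _≈?_ _∈ᵛ?_

-- Triples are compared unordered throughout; the sorted form required of a legal move is produced
-- by `edge`. The implicit vertex lets `to` and `from` act directly on the patterns `1st`, `2nd`,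
-- `3rd`.
record _≈_ (e f : Triple) : Set where
  constructor same
  field
    to   : ∀ {v} → v ∈ᵛ e → v ∈ᵛ f
    from : ∀ {v} → v ∈ᵛ f → v ∈ᵛ e
open _≈_ public

≈-refl : ∀ {e} → e ≈ e
≈-refl = same id id

≈-sym : ∀ {e f} → e ≈ f → f ≈ e
≈-sym p = same (from p) (to p)

≈-trans : ∀ {e f g} → e ≈ f → f ≈ g → e ≈ g
≈-trans p q = same (to q ∘ to p) (from p ∘ from q)

swap₁₂ : ∀ {a b c} → (a , b , c) ≈ (b , a , c)
swap₁₂ = same f f
  where
  f : ∀ {a b c v} → v ∈ᵛ (a , b , c) → v ∈ᵛ (b , a , c)
  f 1st = 2nd
  f 2nd = 1st
  f 3rd = 3rd

swap₂₃ : ∀ {a b c} → (a , b , c) ≈ (a , c , b)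
swap₂₃ = same f f
  where
  f : ∀ {a b c v} → v ∈ᵛ (a , b , c) → v ∈ᵛ (a , c , b)
  f 1st = 1st
  f 2nd = 3rd
  f 3rd = 2nd

_∈ᵛ?_ : ∀ v t → Dec (v ∈ᵛ t)
v ∈ᵛ? (a , b , c) = (v ≟ a) ⊎-dec (v ≟ b) ⊎-dec (v ≟ c)

_⊆ᵛ?_ : ∀ s t → Dec (∀ v → v ∈ᵛ s → v ∈ᵛ t)
(a , b , c) ⊆ᵛ? t = map′
  (λ { (p , q , r) _ 1st → p ; (p , q , r) _ 2nd → q ; (p , q , r) _ 3rd → r })
  (λ f → f _ 1st , f _ 2nd , f _ 3rd)
  ((a ∈ᵛ? t) ×-dec (b ∈ᵛ? t) ×-dec (c ∈ᵛ? t))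

_≈?_ : ∀ s t → Dec (s ≈ t)
s ≈? t = map′ (λ { (p , q) → same (p _) (q _) }) (λ p → (λ _ → to p) , (λ _ → from p)) ((s ⊆ᵛ? t) ×-dec (t ⊆ᵛ? s))

third-unique : ∀ {a b w w′ t} → (a , b , w) ≈ t → (a , b , w′) ≈ t → w ≢ a → w ≢ b → w ≡ w′
third-unique p q w≢a w≢b with from q (to p 3rd)
... | inj₁ w≡a = ⊥-elim (w≢a w≡a)
... | inj₂ (inj₁ w≡b) = ⊥-elim (w≢b w≡b)
... | inj₂ (inj₂ w≡w′) = w≡w′

min≤ : ∀ {a b c v} → BoardEdge (a , b , c) → v ∈ᵛ (a , b , c) → a ≤ v
min≤ (a<b , b<c) 1st = ≤-refl
min≤ (a<b , b<c) 2nd = <⇒≤ a<b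
min≤ (a<b , b<c) 3rd = <⇒≤ (<-trans a<b b<c)

≤max : ∀ {a b c v} → BoardEdge (a , b , c) → v ∈ᵛ (a , b , c) → v ≤ c
≤max (a<b , b<c) 1st = <⇒≤ (<-trans a<b b<c)
≤max (a<b , b<c) 2nd = <⇒≤ b<c
≤max (a<b , b<c) 3rd = ≤-refl

≈⇒≡ : ∀ {s t} → BoardEdge s → BoardEdge t → s ≈ t → s ≡ t
≈⇒≡ {a , b , c} {a′ , b′ , c′} s< t< p
  with ≤-antisym (min≤ s< (from p 1st)) (min≤ t< (to p 1st))
     | ≤-antisym (≤max t< (to p 3rd)) (≤max s< (from p 3rd))
... | refl | refl with to p 2nd
...   | 1st = ⊥-elim (<-irrefl refl (proj₁ s<))
...   | 2nd = refl
...   | 3rd = ⊥-elim (<-irrefl refl (proj₂ s<))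

private
  edge-< : ∀ {a b c} → a < b → a ≢ c → b ≢ c → Σ Triple λ t → BoardEdge t × (a , b , c) ≈ t
  edge-< {a} {b} {c} a<b a≢c b≢c with <-cmp a c | <-cmp b c
  ... | tri≈ _ a≡c _ | _ = ⊥-elim (a≢c a≡c)
  ... | _ | tri≈ _ b≡c _ = ⊥-elim (b≢c b≡c)
  ... | _ | tri< b<c _ _ = _ , (a<b , b<c) , ≈-refl
  ... | tri< a<c _ _ | tri> _ _ c<b = _ , (a<c , c<b) , swap₂₃
  ... | tri> _ _ c<a | tri> _ _ _ = _ , (c<a , a<b) , ≈-trans swap₂₃ swap₁₂

edge : ∀ {a b c} → a ≢ b → a ≢ c → b ≢ c → Σ Triple λ t → BoardEdge t × (a , b , c) ≈ t
edge {a} {b} a≢b a≢c b≢c with <-cmp a b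
... | tri< a<b _ _ = edge-< a<b a≢c b≢c
... | tri≈ _ a≡b _ = ⊥-elim (a≢b a≡b)
... | tri> _ _ b<a = let t , t< , p = edge-< b<a b≢c a≢c in t , t< , ≈-trans swap₁₂ p

_∈ₑ_ : Triple → List Triple → Set
t ∈ₑ S = Any (t ≈_) S

E : List Triple → ℕ → ℕ → ℕ → Set
E S a b c = (a , b , c) ∈ₑ S

_∈ₑ?_ : ∀ t S → Dec (t ∈ₑ S)
t ∈ₑ? S = Any.any? (t ≈?_) S

∈ₑ-resp : ∀ {s t S} → s ≈ t → s ∈ₑ S → t ∈ₑ S
∈ₑ-resp p = Any.map (≈-trans (≈-sym p))

E₁₂ : ∀ {S a b c} → E S a b c → E S b a c
E₁₂ = ∈ₑ-resp swap₁₂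

E₂₃ : ∀ {S a b c} → E S a b c → E S a c b
E₂₃ = ∈ₑ-resp swap₂₃

∈⇒∈ₑ : ∀ {t S} → t ∈ S → t ∈ₑ S
∈⇒∈ₑ = Any.map λ { refl → ≈-refl }

∈ₑ-mono : ∀ {S S′} → (∀ {t} → t ∈ S → t ∈ S′) → ∀ {t} → t ∈ₑ S → t ∈ₑ S′
∈ₑ-mono {S′ = S′} sub {t} = go sub
  where
  go : ∀ {S} → (∀ {t} → t ∈ S → t ∈ S′) → t ∈ₑ S → t ∈ₑ S′
  go sub (here p) = ∈ₑ-resp (≈-sym p) (∈⇒∈ₑ (sub (here refl)))
  go sub (there i) = go (sub ∘ there) i

∈ₑ-witness : ∀ {t S} → t ∈ₑ S → Σ Triple λ u → u ∈ S × t ≈ u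
∈ₑ-witness (here p) = _ , here refl , p
∈ₑ-witness (there i) = let u , u∈ , p = ∈ₑ-witness i in u , there u∈ , p

uncons : ∀ {t x S} → t ∈ₑ x ∷ S → t ≈ x ⊎ t ∈ₑ S
uncons (here p) = inj₁ p
uncons (there i) = inj₂ i

-- Counting

record Pruned {A : Set} (R : A → A → Set) (Q : A → Set) (ys : List A) : Set where
  field
    rest  : List A
    sub   : ∀ {y} → y ∈ rest → y ∈ ys
    pairs : AllPairs R rest
    all   : All Q rest
    size  : length ys ≤ suc (length rest)

-- Two entries labelled `P` would contradict `once`, so deleting at most one entry leaves only the
-- label `Q`. The pigeonhole arguments and degree bounds below iterate this.
prune : {A : Set} {R : A → A → Set} {P Q : A → Set} → (∀ {y y′} → R y y′ → P y → P y′ → ⊥) →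
        ∀ {ys} → AllPairs R ys → All (λ y → P y ⊎ Q y) ys → Pruned R Q ys
prune once [] [] = record { rest = [] ; sub = λ () ; pairs = [] ; all = [] ; size = z≤n }
prune {A} {R} {P} {Q} once {y ∷ ys} (r ∷ rs) (inj₁ py ∷ pqs) = record
  { rest = ys ; sub = there ; pairs = rs ; all = others r pqs ; size = ≤-refl }
  where
  others : ∀ {zs} → All (R y) zs → All (λ z → P z ⊎ Q z) zs → All Q zs
  others [] [] = []
  others (r ∷ rs) (inj₁ pz ∷ pqs) = ⊥-elim (once r py pz)
  others (r ∷ rs) (inj₂ qz ∷ pqs) = qz ∷ others rs pqs
prune once {y ∷ ys} (r ∷ rs) (inj₂ qy ∷ pqs) = record
  { rest = y ∷ rest
  ; sub = λ { (here p) → here p ; (there i) → there (sub i) }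
  ; pairs = All.tabulate (λ i → All.lookup r (sub i)) ∷ pairs
  ; all = qy ∷ all
  ; size = s≤s size }
  where open Pruned (prune once rs pqs)

without : ∀ v {U : List ℕ} → Unique U → Pruned _≢_ (_≢ v) U
without v U! = prune {P = _≡ v} (λ { y≢y′ refl refl → y≢y′ refl }) U! (All.tabulate λ {u} _ → toSum (u ≟ v))

Different : List Triple → Set
Different = AllPairs (λ s t → ¬ s ≈ t)

pigeonhole : ∀ xs {ys} → Different ys → All (_∈ₑ xs) ys → length ys ≤ length xs
pigeonhole [] {[]} _ _ = z≤n
pigeonhole [] {_ ∷ _} _ (() ∷ _)
pigeonhole (x ∷ xs) ys! ys∈ = ≤-trans size (s≤s (pigeonhole xs pairs all))
  where
  open Pruned (prune (λ s≉t s≈x t≈x → s≉t (≈-trans s≈x (≈-sym t≈x))) ys! (All.map uncons ys∈))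

-- Stars and books

-- A witness that the pair ab has degree at least `length ws`. Leaves differ from a and b so that
-- distinct leaves give distinct edges.
record Star (S : List Triple) (a b : ℕ) (ws : List ℕ) : Set where
  constructor star
  field
    leaves : Unique ws
    rays   : All (λ w → E S a b w × w ≢ a × w ≢ b) ws
open Star public

star-swap : ∀ {S a b ws} → Star S a b ws → Star S b a ws
star-swap (star u r) = star u (All.map (λ { (p , q , s) → E₁₂ p , s , q }) r)

record Shrunk (S : List Triple) (a b : ℕ) (n : ℕ) (ws : List ℕ) : Set where
  field
    kept  : List ℕ
    kept⊆ : ∀ {w} → w ∈ kept → w ∈ ws
    left  : Star S a b kept
    lost  : length ws ≤ n + length kept

-- An edge through a and b determines its third vertex, so losing one edge costs at most one leaf.
star-tail : ∀ {x S a b ws} → Star (x ∷ S) a b ws → Shrunk S a b 1 ws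
star-tail {x} {S} {a} {b} (star u r) = record
  { kept = rest ; kept⊆ = sub ; left = star pairs all ; lost = size }
  where
  pruned : Pruned _≢_ (λ w → E S a b w × w ≢ a × w ≢ b) _
  pruned = prune {P = λ w → (a , b , w) ≈ x × w ≢ a × w ≢ b}
    (λ { w≢w′ (p , w≢a , w≢b) (q , _) → w≢w′ (third-unique p q w≢a w≢b) }) u
    (All.map (λ { (p , d) → [ (λ p → inj₁ (p , d)) , (λ p → inj₂ (p , d)) ]′ (uncons p) }) r)
  open Pruned pruned

star-skip : ∀ {x S a b ws} → (∀ w → ¬ (a , b , w) ≈ x) → Star (x ∷ S) a b ws → Star S a b ws
star-skip ≉x (star u r) = star u (All.map (λ { (p , d) → [ ⊥-elim ∘ ≉x _ , id ]′ (uncons p) , d }) r)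

star-suffix : ∀ ex {S a b ws} → Star (ex ++ S) a b ws → Shrunk S a b (length ex) ws
star-suffix [] s = record { kept = _ ; kept⊆ = id ; left = s ; lost = ≤-refl }
star-suffix (x ∷ ex) s = record
  { kept = R.kept ; kept⊆ = T.kept⊆ ∘ R.kept⊆ ; left = R.left
  ; lost = ≤-trans T.lost (s≤s R.lost) }
  where
  module T = Shrunk (star-tail s)
  module R = Shrunk (star-suffix ex T.left)

-- An edge of `ex` off the pair ab costs no leaf, which improves `star-suffix` by one.
star-suffix′ : ∀ ex {S a b ws} → Any (λ x → ∀ w → ¬ (a , b , w) ≈ x) ex → Star (ex ++ S) a b ws →
               Σ (List ℕ) λ vs → Star S a b vs × suc (length ws) ≤ length ex + length vs
star-suffix′ (x ∷ ex) (here ≉x) s = R.kept , R.left , s≤s R.lost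
  where module R = Shrunk (star-suffix ex (star-skip ≉x s))
star-suffix′ (x ∷ ex) (there i) s =
  let vs , s′ , l = star-suffix′ ex i T.left in vs , s′ , s≤s (≤-trans T.lost l)
  where module T = Shrunk (star-tail s)

-- Four pages make a copy of G and three a core; one or two pages occur while P₂ is building. In the
-- link of C this is a graph of triangles on the common edge XY.
record Book (S : List Triple) (C X Y : ℕ) (U : List ℕ) : Set where
  constructor book
  field
    distinct : Unique (C ∷ X ∷ Y ∷ U)
    spine    : E S C X Y
    pageX    : All (E S C X) U
    pageY    : All (E S C Y) U

  C≢X : C ≢ X
  C≢X with (p ∷ _) ∷ _ ← distinct = p
  C≢Y : C ≢ Y
  C≢Y with (_ ∷ p ∷ _) ∷ _ ← distinct = p
  C≢U : All (C ≢_) U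
  C≢U with (_ ∷ _ ∷ p) ∷ _ ← distinct = p
  X≢Y : X ≢ Y
  X≢Y with _ ∷ (p ∷ _) ∷ _ ← distinct = p
  X≢U : All (X ≢_) U
  X≢U with _ ∷ (_ ∷ p) ∷ _ ← distinct = p
  Y≢U : All (Y ≢_) U
  Y≢U with _ ∷ _ ∷ p ∷ _ ← distinct = p
  U! : Unique U
  U! with _ ∷ _ ∷ _ ∷ p ← distinct = p

  leaf≢ : ∀ {u} → u ∈ U → u ≢ C × u ≢ X × u ≢ Y
  leaf≢ i = ≢-sym (All.lookup C≢U i) , ≢-sym (All.lookup X≢U i) , ≢-sym (All.lookup Y≢U i)

  starX : Star S C X (Y ∷ U)
  starX = star (Y≢U ∷ U!) ((spine , ≢-sym C≢Y , ≢-sym X≢Y) ∷ rays′ pageX C≢U X≢U)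
    where
    rays′ : ∀ {V} → All (E S C X) V → All (C ≢_) V → All (X ≢_) V →
            All (λ w → E S C X w × w ≢ C × w ≢ X) V
    rays′ [] [] [] = []
    rays′ (e ∷ es) (p ∷ ps) (q ∷ qs) = (e , ≢-sym p , ≢-sym q) ∷ rays′ es ps qs

book-swap : ∀ {S C X Y U} → Book S C X Y U → Book S C Y X U
book-swap b@(book ((p ∷ q ∷ r) ∷ (s ∷ t) ∷ u ∷ v) h x y) =
  book ((q ∷ p ∷ r) ∷ (≢-sym s ∷ u) ∷ t ∷ v) (E₂₃ h) y x

book-map : ∀ {S S′ C X Y U} → (∀ {t} → t ∈ₑ S → t ∈ₑ S′) → Book S C X Y U → Book S′ C X Y U
book-map f (book d h x y) = book d (f h) (All.map f x) (All.map f y)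

bookEdges : ℕ → ℕ → ℕ → List ℕ → List Triple
bookEdges C X Y U = (C , X , Y) ∷ map (λ u → C , X , u) U ++ map (λ u → C , Y , u) U

star-different : ∀ {S a b ws} → Star S a b ws → Different (map (λ w → a , b , w) ws)
star-different {a = a} {b} (star u r) = AllPairsₚ.map⁺ (go u r)
  where
  go : ∀ {S ws} → Unique ws → All (λ w → E S a b w × w ≢ a × w ≢ b) ws →
       AllPairs (λ w w′ → ¬ (a , b , w) ≈ (a , b , w′)) ws
  go [] [] = []
  go (u ∷ us) ((_ , w≢a , w≢b) ∷ rs) =
    All.map (λ w≢w′ p → w≢w′ (third-unique p ≈-refl w≢a w≢b)) u ∷ go us rs

module _ {S C X Y U} (b : Book S C X Y U) where
  open Book b

  X-page≉Y-page : ∀ {u v} → X ≢ u → ¬ (C , X , v) ≈ (C , Y , u)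
  X-page≉Y-page X≢u p with to p 2nd
  ... | inj₁ e = C≢X (sym e)
  ... | inj₂ (inj₁ e) = X≢Y e
  ... | inj₂ (inj₂ e) = X≢u e

  bookEdges∈ : All (_∈ₑ S) (bookEdges C X Y U)
  bookEdges∈ = spine ∷ Allₚ.++⁺ (Allₚ.map⁺ pageX) (Allₚ.map⁺ pageY)

  bookEdges-different : Different (bookEdges C X Y U)
  bookEdges-different = AllPairsₚ.++⁺ (star-different starX)
    (AllPairs.tail (star-different (Book.starX (book-swap b))))
    (Allₚ.map⁺ (All.tabulate λ _ → Allₚ.map⁺ (All.map X-page≉Y-page X≢U)))

-- Copies of G as books with four pages

∈ₑ⇒HasEdge : ∀ {S t} → t ∈ₑ S → HasEdge S t
∈ₑ⇒HasEdge = Any.map λ p v → mk⇔ (to p) (from p)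

HasEdge⇒∈ₑ : ∀ {S t} → HasEdge S t → t ∈ₑ S
HasEdge⇒∈ₑ = Any.map λ p → same (λ {v} → Equivalence.to (p v)) (λ {v} → Equivalence.from (p v))

record Copy (S : List Triple) : Set where
  constructor copy
  field
    {C X Y u₁ u₂ u₃ u₄} : ℕ
    theBook : Book S C X Y (u₁ ∷ u₂ ∷ u₃ ∷ u₄ ∷ [])

HasCopyG⇒Copy : ∀ {S} → HasCopyG S → Copy S
HasCopyG⇒Copy {S} (φ , φ-inj , e₁ ∷ e₂ ∷ e₃ ∷ e₄ ∷ e₅ ∷ e₆ ∷ e₇ ∷ e₈ ∷ e₉ ∷ []) = copy (book
  ((d (λ ()) ∷ d (λ ()) ∷ d (λ ()) ∷ d (λ ()) ∷ d (λ ()) ∷ d (λ ()) ∷ []) ∷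
   (d (λ ()) ∷ d (λ ()) ∷ d (λ ()) ∷ d (λ ()) ∷ d (λ ()) ∷ []) ∷
   (d (λ ()) ∷ d (λ ()) ∷ d (λ ()) ∷ d (λ ()) ∷ []) ∷
   (d (λ ()) ∷ d (λ ()) ∷ d (λ ()) ∷ []) ∷
   (d (λ ()) ∷ d (λ ()) ∷ []) ∷
   (d (λ ()) ∷ []) ∷ [] ∷ [])
  (h e₁) (h e₂ ∷ h e₃ ∷ h e₄ ∷ h e₅ ∷ []) (h e₆ ∷ h e₇ ∷ h e₈ ∷ h e₉ ∷ []))
  where
  d : ∀ {i j} → i ≢ j → φ i ≢ φ j
  d i≢j e = i≢j (φ-inj e)
  h : ∀ {t} → HasEdge S t → t ∈ₑ S
  h = HasEdge⇒∈ₑ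

Copy⇒HasCopyG : ∀ {S} → Copy S → HasCopyG S
Copy⇒HasCopyG {S} (copy {C} {X} {Y} {u₁} {u₂} {u₃} {u₄} (book d e₁ (e₂ ∷ e₃ ∷ e₄ ∷ e₅ ∷ []) (e₆ ∷ e₇ ∷ e₈ ∷ e₉ ∷ []))) =
  Vec.lookup vs , (λ {i} {j} → lookup-injective (unique d) i j) ,
  h e₁ ∷ h e₂ ∷ h e₃ ∷ h e₄ ∷ h e₅ ∷ h e₆ ∷ h e₇ ∷ h e₈ ∷ h e₉ ∷ []
  where
  vs = Vec.fromList (C ∷ X ∷ Y ∷ u₁ ∷ u₂ ∷ u₃ ∷ u₄ ∷ [])
  fromAll : ∀ {P : ℕ → Set} {xs} → All P xs → VecAll.All P (Vec.fromList xs)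
  fromAll [] = VecAll.[]
  fromAll (p ∷ ps) = p VecAll.∷ fromAll ps
  unique : ∀ {xs : List ℕ} → Unique xs → VecAllPairs.AllPairs _≢_ (Vec.fromList xs)
  unique [] = VecAllPairs.[]
  unique (p ∷ ps) = fromAll p VecAllPairs.∷ unique ps
  h : ∀ {t} → t ∈ₑ S → HasEdge S t
  h = ∈ₑ⇒HasEdge

copy-map : ∀ {S S′} → (∀ {t} → t ∈ₑ S → t ∈ₑ S′) → Copy S → Copy S′
copy-map f (copy b) = copy (book-map f b)

-- Fresh vertices

bound : List Triple → ℕ
bound [] = 0
bound ((a , b , c) ∷ S) = suc (a ⊔ (b ⊔ c)) ⊔ bound S

∈⇒<bound : ∀ {S t v} → t ∈ S → v ∈ᵛ t → v < bound S
∈⇒<bound {(a , b , c) ∷ S} (here refl) v∈t = ≤-trans (s≤s (v≤ v∈t)) (m≤m⊔n _ (bound S))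
  where
  v≤ : ∀ {v} → v ∈ᵛ (a , b , c) → v ≤ a ⊔ (b ⊔ c)
  v≤ 1st = m≤m⊔n a _
  v≤ 2nd = ≤-trans (m≤m⊔n b c) (m≤n⊔m a _)
  v≤ 3rd = ≤-trans (m≤n⊔m b c) (m≤n⊔m a _)
∈⇒<bound {(a , b , c) ∷ S} (there i) v∈t = ≤-trans (∈⇒<bound i v∈t) (m≤n⊔m (suc (a ⊔ (b ⊔ c))) (bound S))

freshEdge : History → Triple
freshEdge h = bound h , suc (bound h) , suc (suc (bound h))

freshEdge-legal : ∀ h → Legal h (freshEdge h)
freshEdge-legal h = (n<1+n _ , n<1+n _) , λ i → <-irrefl refl (∈⇒<bound i 1st)

-- Histories

-- Histories with P₁ to move. Only after an even number of moves do `evens` and `odds` commute with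
-- appending; otherwise the two players trade places in the appended part.
data Rounds : History → Set where
  []  : Rounds []
  _∷∷_ : ∀ ab {h} → Rounds h → Rounds (proj₁ ab ∷ proj₂ ab ∷ h)

rounds-++ : ∀ {h g} → Rounds h → Rounds g → Rounds (h ++ g)
rounds-++ [] g = g
rounds-++ (ab ∷∷ h) g = ab ∷∷ rounds-++ h g

evens-++ : ∀ {h} g → Rounds h → evens (h ++ g) ≡ evens h ++ evens g
evens-++ g [] = refl
evens-++ g ((a , b) ∷∷ h) = cong (a ∷_) (evens-++ g h)

odds-++ : ∀ {h} g → Rounds h → odds (h ++ g) ≡ odds h ++ odds g
odds-++ g [] = refl
odds-++ g ((a , b) ∷∷ h) = cong (b ∷_) (odds-++ g h)

odds⊆ : ∀ {h t} → Rounds h → t ∈ odds h → t ∈ h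
odds⊆ (_ ∷∷ h) (here p) = there (here p)
odds⊆ (_ ∷∷ h) (there i) = there (there (odds⊆ h i))

⊆evens⊎odds : ∀ h {t} → t ∈ h → t ∈ evens h ⊎ t ∈ odds h
⊆evens⊎odds (e ∷ h) (here p) = inj₁ (here p)
⊆evens⊎odds (e ∷ h) (there i) = [ inj₂ , inj₁ ∘ there ]′ (⊆evens⊎odds h i)

hasCopy-mono : ∀ {S S′} → (∀ {t} → t ∈ S → t ∈ S′) → HasCopyG S → HasCopyG S′
hasCopy-mono sub c = Copy⇒HasCopyG (copy-map (∈ₑ-mono sub) (HasCopyG⇒Copy c))

_≟ᵗ_ : (s t : Triple) → Dec (s ≡ t)
_≟ᵗ_ = ≡-dec _≟_ (≡-dec _≟_ _≟_)

open DecMembership _≟ᵗ_ using () renaming (_∈?_ to _∈ᵗ?_)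

legal? : ∀ h t → Dec (Legal h t)
legal? h t@(a , b , c) = ((a <? b) ×-dec (b <? c)) ×-dec ¬? (t ∈ᵗ? h)

double : ℕ → ℕ
double zero = zero
double (suc k) = suc (suc (double k))

isEven-double : ∀ k → isEven (double k) ≡ true
isEven-double zero = refl
isEven-double (suc k) rewrite isEven-double k = refl

even⊎odd : ∀ n → Σ ℕ λ k → n ≡ double k ⊎ n ≡ suc (double k)
even⊎odd zero = 0 , inj₁ refl
even⊎odd (suc n) with even⊎odd n
... | k , inj₁ refl = k , inj₂ refl
... | k , inj₂ refl = suc k , inj₁ refl

double-mono-< : ∀ {i k} → i ≤ k → double i < suc (double k)
double-mono-< z≤n = s≤s z≤n
double-mono-< (s≤s p) = s≤s (s≤s (double-mono-< p))

module Game (σ₁ : Strategy) where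

  next : History → Triple → History
  next h m = h ++ σ₁ h ∷ m ∷ []

  after : History → (ℕ → Triple) → ℕ → History
  after h s zero = h
  after h s (suc k) = after (next h (s 0)) (s ∘ suc) k

  LegalMoves : History → (ℕ → Triple) → Set
  LegalMoves h s = ∀ k → Legal (after h s k ++ [ σ₁ (after h s k) ]) (s k)

  -- Against the fixed σ₁ a play of P₂ is just a sequence of moves. The number counts the full
  -- rounds before her winning move; recursion consumes the sequence from the front, so after a
  -- round the claim about the rest of the game has the same form.
  WinsIn : ℕ → History → (ℕ → Triple) → Set
  WinsIn zero h s = Legal h (σ₁ h) × HasCopyG (evens (h ++ [ σ₁ h ])) × ¬ HasCopyG (odds (h ++ [ σ₁ h ]))
  WinsIn (suc k) h s = Legal h (σ₁ h) × WinsIn k (next h (s 0)) (s ∘ suc)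

  Win : History → Set
  Win h = ∀ s → LegalMoves h s → Σ ℕ λ k → WinsIn k h s

  winsIn-legal : ∀ k {h s} → WinsIn k h s → Legal h (σ₁ h)
  winsIn-legal zero (l , _) = l
  winsIn-legal (suc k) (l , _) = l

  -- P₁Wins quantifies over strategies that are legal on all histories, reachable or not, so σ₂ plays the sequence s
  -- where this is legal and a fresh edge elsewhere.
  module Start (wins : P₁Wins σ₁) (s : ℕ → Triple) (s-legal : LegalMoves [] s) where

    σ₂ : Strategy
    σ₂ h with legal? h (s ⌊ length h /2⌋)
    ... | yes _ = s ⌊ length h /2⌋
    ... | no _ = freshEdge h

    σ₂-legal : ∀ h → Legal h (σ₂ h)
    σ₂-legal h with legal? h (s ⌊ length h /2⌋)
    ... | yes l = l
    ... | no _ = freshEdge-legal h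

    σ₂-follows : ∀ h k → ⌊ length h /2⌋ ≡ k → Legal h (s k) → σ₂ h ≡ s k
    σ₂-follows h k refl l with legal? h (s ⌊ length h /2⌋)
    ... | yes _ = refl
    ... | no ¬l = ⊥-elim (¬l l)

    H : ℕ → History
    H = after [] s

    after-suc : ∀ k h s → after h s (suc k) ≡ next (after h s k) (s k)
    after-suc zero h s = refl
    after-suc (suc k) h s = after-suc k (next h (s 0)) (s ∘ suc)

    length-H : ∀ k → length (H k) ≡ double k
    length-H zero = refl
    length-H (suc k) = begin
      length (H (suc k))           ≡⟨ cong length (after-suc k [] s) ⟩
      length (next (H k) (s k))    ≡⟨ length-++ (H k) ⟩
      length (H k) + 2             ≡⟨ +-comm (length (H k)) 2 ⟩
      2 + length (H k)             ≡⟨ cong (2 +_) (length-H k) ⟩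
      double (suc k)               ∎
      where open ≡-Reasoning

    half-double : ∀ k → ⌊ suc (double k) /2⌋ ≡ k
    half-double zero = refl
    half-double (suc k) = cong suc (half-double k)

    half-length : ∀ k t → ⌊ length (H k ++ [ t ]) /2⌋ ≡ k
    half-length k t = trans
      (cong ⌊_/2⌋ (trans (length-++ (H k)) (trans (+-comm (length (H k)) 1) (cong suc (length-H k)))))
      (half-double k)

    mover-even : ∀ n → isEven n ≡ true → mover σ₁ σ₂ n ≡ σ₁
    mover-even n e with true ← isEven n = refl

    mover-odd : ∀ n → isEven n ≡ true → mover σ₁ σ₂ (suc n) ≡ σ₂
    mover-odd n e with true ← isEven n = refl

    play-double : ∀ k → play σ₁ σ₂ (double k) ≡ H k
    play-double+1 : ∀ k → play σ₁ σ₂ (suc (double k)) ≡ H k ++ [ σ₁ (H k) ]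

    play-double+1 k rewrite mover-even (double k) (isEven-double k) | play-double k = refl

    play-double zero = refl
    play-double (suc k)
      rewrite mover-odd (double k) (isEven-double k) | play-double+1 k = begin
      (H k ++ [ σ₁ (H k) ]) ++ [ σ₂ (H k ++ [ σ₁ (H k) ]) ]
        ≡⟨ ++-assoc (H k) _ _ ⟩
      H k ++ σ₁ (H k) ∷ σ₂ (H k ++ [ σ₁ (H k) ]) ∷ []
        ≡⟨ cong (next (H k)) (σ₂-follows (H k ++ [ σ₁ (H k) ]) k (half-length k _) (s-legal k)) ⟩
      next (H k) (s k)
        ≡⟨ sym (after-suc k [] s) ⟩
      H (suc k) ∎
      where open ≡-Reasoning

    rounds-H : ∀ k → Rounds (H k)
    rounds-H zero = []
    rounds-H (suc k) = subst Rounds (sym (after-suc k [] s)) (rounds-++ (rounds-H k) (_ ∷∷ []))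

    winsIn : ∀ k {h s} → (∀ i → i ≤ k → Legal (after h s i) (σ₁ (after h s i))) →
             HasCopyG (evens (after h s k ++ [ σ₁ (after h s k) ])) →
             ¬ HasCopyG (odds (after h s k ++ [ σ₁ (after h s k) ])) → WinsIn k h s
    winsIn zero l c ¬c = l 0 z≤n , c , ¬c
    winsIn (suc k) l c ¬c = l 0 z≤n , winsIn k (λ i p → l (suc i) (s≤s p)) c ¬c

    outcome : Σ ℕ λ k → WinsIn k [] s
    outcome with wins σ₂ σ₂-legal
    ... | n , legal , c , ¬c with even⊎odd n
    ...   | k , inj₂ refl rewrite play-double+1 k = k , winsIn k
            (λ i p → subst (λ h → Legal h (σ₁ h)) (play-double i) (legal (double i) (double-mono-< p) (isEven-double i)))
            c ¬c
    ...   | zero , inj₁ refl with () ∷ _ ← proj₂ (proj₂ c)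
    -- If the win is observed right after a move of P₂, it was already there before that move, which
    -- adds nothing to her edges and can only enlarge his.
    ...   | suc k , inj₁ refl = k , winsIn k
            (λ i p → subst (λ h → Legal h (σ₁ h)) (play-double i)
                       (legal (double i) (m<n⇒m<1+n (double-mono-< p)) (isEven-double i)))
            (hasCopy-mono evens⊆′ (subst (HasCopyG ∘ evens) H-suc c))
            (λ c′ → ¬c (subst (HasCopyG ∘ odds) (sym H-suc) (hasCopy-mono odds⊆′ c′)))
      where
      H-suc : play σ₁ σ₂ (double (suc k)) ≡ next (H k) (s k)
      H-suc = trans (play-double (suc k)) (after-suc k [] s)
      evens⊆′ : ∀ {t} → t ∈ evens (next (H k) (s k)) → t ∈ evens (H k ++ [ σ₁ (H k) ])
      evens⊆′ rewrite evens-++ (σ₁ (H k) ∷ s k ∷ []) (rounds-H k) | evens-++ [ σ₁ (H k) ] (rounds-H k) = id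
      odds⊆′ : ∀ {t} → t ∈ odds (H k ++ [ σ₁ (H k) ]) → t ∈ odds (next (H k) (s k))
      odds⊆′ rewrite odds-++ (σ₁ (H k) ∷ s k ∷ []) (rounds-H k) | odds-++ [ σ₁ (H k) ] (rounds-H k) =
        [ ∈-++⁺ˡ , (λ ()) ]′ ∘ ∈-++⁻ (odds (H k))

  -- A position with P₁ to move, A and B being the edges of P₁ and P₂, from which σ₁ still wins.
  record Position (A B : List Triple) : Set where
    field
      {h}      : History
      rounds   : Rounds h
      evens⊆A  : ∀ {t} → t ∈ evens h → t ∈ A
      odds⊆B   : ∀ {t} → t ∈ odds h → t ∈ B
      B⊆odds   : ∀ {t} → t ∈ B → t ∈ odds h
      boardB   : ∀ {t} → t ∈ B → BoardEdge t
      disjoint : ∀ {t} → t ∈ₑ A → ¬ t ∈ₑ B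
      win      : Win h

    reply : Triple
    reply = σ₁ h

    private
      -- `Win` says something only along a legal continuation. Any one will do to extract that the
      -- next reply is legal and that P₂ has no copy yet; this one plays fresh edges forever.
      someMoves : History → ℕ → Triple
      someMoves h zero = freshEdge (h ++ [ σ₁ h ])
      someMoves h (suc k) = someMoves (next h (freshEdge (h ++ [ σ₁ h ]))) k

      someMoves-legal : ∀ h → LegalMoves h (someMoves h)
      someMoves-legal h zero = freshEdge-legal (h ++ [ σ₁ h ])
      someMoves-legal h (suc k) = someMoves-legal (next h (freshEdge (h ++ [ σ₁ h ]))) k

      winsIn-noCopy : ∀ k {h s} → Rounds h → WinsIn k h s → ¬ HasCopyG (odds h)
      winsIn-noCopy zero {h} r (_ , _ , ¬c) c = ¬c (hasCopy-mono
        (λ {t} i → subst (t ∈_) (sym (odds-++ [ σ₁ h ] r)) (∈-++⁺ˡ i)) c)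
      winsIn-noCopy (suc k) {h} {s} r (_ , w) c = winsIn-noCopy k (rounds-++ r (_ ∷∷ [])) w (hasCopy-mono
        (λ {t} i → subst (t ∈_) (sym (odds-++ (σ₁ h ∷ s 0 ∷ []) r)) (∈-++⁺ˡ i)) c)

      somePlay : Σ ℕ λ k → WinsIn k h (someMoves h)
      somePlay = win (someMoves h) (someMoves-legal h)

    reply-legal : Legal h reply
    reply-legal = winsIn-legal (proj₁ somePlay) (proj₂ somePlay)

    reply-board : BoardEdge reply
    reply-board = proj₁ reply-legal

    reply∉B : ¬ reply ∈ₑ B
    reply∉B i with u , u∈ , p ← ∈ₑ-witness i with refl ← ≈⇒≡ reply-board (boardB u∈) p =
      proj₂ reply-legal (odds⊆ rounds (B⊆odds u∈))

    disjoint′ : ∀ {t} → t ∈ₑ reply ∷ A → ¬ t ∈ₑ B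
    disjoint′ (here p) j = reply∉B (∈ₑ-resp p j)
    disjoint′ (there i) j = disjoint i j

    copy-now : HasCopyG (evens (h ++ [ σ₁ h ])) → Copy (reply ∷ A)
    copy-now c = copy-map (∈ₑ-mono now) (HasCopyG⇒Copy c)
      where
      now : ∀ {t} → t ∈ evens (h ++ [ σ₁ h ]) → t ∈ reply ∷ A
      now {t} i with ∈-++⁻ (evens h) (subst (t ∈_) (evens-++ [ σ₁ h ] rounds) i)
      ... | inj₁ j = there (evens⊆A j)
      ... | inj₂ (here p) = here p

    lost : ¬ Copy B
    lost c = winsIn-noCopy (proj₁ somePlay) rounds (proj₂ somePlay)
               (Copy⇒HasCopyG (copy-map (∈ₑ-mono B⊆odds) c))

  open Position using (reply)

  initial : P₁Wins σ₁ → Position [] []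
  initial wins = record
    { rounds = [] ; evens⊆A = id ; odds⊆B = id ; B⊆odds = id
    ; boardB = λ () ; disjoint = λ ()
    ; win = Start.outcome wins }

  -- The move m follows the reply of P₁. By `noCopy` that reply did not end the game, so the win
  -- promised by σ₁ must lie after m.
  record Move {A B} (P : Position A B) (m : Triple) : Set where
    field
      noCopy : ¬ Copy (reply P ∷ A)
      board  : BoardEdge m
      m∉A    : ¬ m ∈ₑ reply P ∷ A
      m∉B    : ¬ m ∈ₑ B

    open Position P hiding (reply)

    m-legal : Legal (h ++ [ σ₁ h ]) m
    m-legal = board , λ i → [ in-h , in-[r] ]′ (∈-++⁻ h i)
      where
      in-h : ¬ m ∈ h
      in-h i = [ m∉A ∘ there ∘ ∈⇒∈ₑ ∘ evens⊆A , m∉B ∘ ∈⇒∈ₑ ∘ odds⊆B ]′ (⊆evens⊎odds h i)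
      in-[r] : ¬ m ∈ [ σ₁ h ]
      in-[r] (here p) = m∉A (here (subst (_≈ σ₁ h) (sym p) ≈-refl))

    advance : Position (reply P ∷ A) (m ∷ B)
    advance = record
      { h = next h m
      ; rounds = rounds-++ rounds (_ ∷∷ [])
      ; evens⊆A = λ {t} i → [ there ∘ evens⊆A , (λ { (here p) → here p }) ]′
                    (∈-++⁻ (evens h) (subst (t ∈_) evens-next i))
      ; odds⊆B = λ {t} i → [ there ∘ odds⊆B , (λ { (here p) → here p }) ]′
                    (∈-++⁻ (odds h) (subst (t ∈_) odds-next i))
      ; B⊆odds = λ {t} i → subst (t ∈_) (sym odds-next) (toOdds i)
      ; boardB = λ { (here refl) → board ; (there i) → boardB i }
      ; disjoint = λ { i (here p) → m∉A (∈ₑ-resp p i) ; i (there j) → disjoint′ i j }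
      ; win = λ s l → continue s (win (m ◂ s) λ { zero → m-legal ; (suc k) → l k }) }
      where
      evens-next : evens (next h m) ≡ evens h ++ [ σ₁ h ]
      evens-next = evens-++ _ rounds
      odds-next : odds (next h m) ≡ odds h ++ [ m ]
      odds-next = odds-++ _ rounds
      toOdds : ∀ {t} → t ∈ m ∷ B → t ∈ odds h ++ [ m ]
      toOdds (here p) = ∈-++⁺ʳ (odds h) (here p)
      toOdds (there i) = ∈-++⁺ˡ (B⊆odds i)
      _◂_ : Triple → (ℕ → Triple) → ℕ → Triple
      (m ◂ s) zero = m
      (m ◂ s) (suc k) = s k
      continue : ∀ s → Σ ℕ (λ k → WinsIn k h (m ◂ s)) → Σ ℕ λ k → WinsIn k (next h m) s
      continue s (suc k , _ , w) = k , w
      continue s (zero , _ , c , _) = ⊥-elim (noCopy (copy-now c))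

  open Move public using (advance)

  module _ (Inv : List Triple → List Triple → Set)
           (answer : ∀ {A B} (P : Position A B) → Inv A B → Σ Triple λ m → Move P m × Inv (reply P ∷ A) (m ∷ B)) where

    private
      moves : ∀ {A B} → Position A B → Inv A B → ℕ → Triple
      moves P I zero = proj₁ (answer P I)
      moves P I (suc k) = let m , M , I′ = answer P I in moves (advance M) I′ k

      moves-legal : ∀ {A B} (P : Position A B) (I : Inv A B) → LegalMoves (Position.h P) (moves P I)
      moves-legal P I zero = Move.m-legal (proj₁ (proj₂ (answer P I)))
      moves-legal P I (suc k) = let m , M , I′ = answer P I in moves-legal (advance M) I′ k

      refuted : ∀ k {A B} (P : Position A B) (I : Inv A B) → ¬ WinsIn k (Position.h P) (moves P I)
      refuted (suc k) P I (_ , w) = let m , M , I′ = answer P I in refuted k (advance M) I′ w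
      refuted zero P I (_ , c , _) = Move.noCopy (proj₁ (proj₂ (answer P I))) (Position.copy-now P c)

    -- Restoring the invariant after each reply yields an infinite legal sequence along which P₁
    -- never completes a copy, whereas `win` applied to this sequence names a round in which she
    -- does.
    endless : ∀ {A B} → Position A B → ¬ Inv A B
    endless P I with k , w ← Position.win P (moves P I) (moves-legal P I) = refuted k P I w

-- Untouched vertices and edges through them

open DecMembership _≟_ using (_∈?_)

Free : ℕ → List Triple → Set
Free v S = ∀ {t} → t ∈ₑ S → ¬ v ∈ᵛ t

free-≥bound : ∀ {S v} → bound S ≤ v → Free v S
free-≥bound b≤v i v∈t with u , u∈ , p ← ∈ₑ-witness i = <-irrefl refl (≤-trans (∈⇒<bound u∈ (to p v∈t)) b≤v)

fresh : ∀ A B → Σ ℕ λ v → Free v A × Free v B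
fresh A B = bound A ⊔ bound B , free-≥bound (m≤m⊔n (bound A) (bound B)) , free-≥bound (m≤n⊔m (bound A) (bound B))

free-≢ : ∀ {v w S t} → Free v S → t ∈ₑ S → w ∈ᵛ t → w ≢ v
free-≢ free i w∈t refl = free i w∈t

book-restrict : ∀ {v x S C X Y U} → v ∈ᵛ x → ¬ v ∈ C ∷ X ∷ Y ∷ U → Book (x ∷ S) C X Y U → Book S C X Y U
book-restrict {v} {x} {S} {C} {X} {Y} {U} v∈x v∉ (book d e xs ys) =
  book d (in-S (here refl) (there (here refl)) (there (there (here refl))) e)
    (pages (there (here refl)) xs) (pages (there (there (here refl))) ys)
  where
  in-S : ∀ {a b c} → a ∈ C ∷ X ∷ Y ∷ U → b ∈ C ∷ X ∷ Y ∷ U → c ∈ C ∷ X ∷ Y ∷ U → E (x ∷ S) a b c → E S a b c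
  in-S a b c (there i) = i
  in-S a b c (here p) with from p v∈x
  ... | 1st = ⊥-elim (v∉ a)
  ... | 2nd = ⊥-elim (v∉ b)
  ... | 3rd = ⊥-elim (v∉ c)
  pages : ∀ {Z} → Z ∈ C ∷ X ∷ Y ∷ U → All (E (x ∷ S) C Z) U → All (E S C Z) U
  pages Z∈ es = All.tabulate λ i → in-S (here refl) Z∈ (there (there (there i))) (All.lookup es i)

book-sub : ∀ {S C X Y U V} → (∀ {u} → u ∈ V → u ∈ U) → Unique V → Book S C X Y U → Book S C X Y V
book-sub {U = U} {V} sub V! b = book
  ((C≢X ∷ C≢Y ∷ restrict C≢U) ∷ (X≢Y ∷ restrict X≢U) ∷ restrict Y≢U ∷ V!)
  spine (restrict pageX) (restrict pageY)
  where
  open Book b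
  restrict : ∀ {P : ℕ → Set} → All P U → All P V
  restrict ps = All.tabulate (All.lookup ps ∘ sub)

through : ∀ {v ex S} → Free v S → ∀ {t} → v ∈ᵛ t → t ∈ₑ ex ++ S → t ∈ₑ ex
through {ex = []} free v∈t i = ⊥-elim (free i v∈t)
through {ex = x ∷ ex} free v∈t (here p) = here p
through {ex = x ∷ ex} free v∈t (there i) = there (through free v∈t i)

star-through : ∀ {v ex S a b ws} → Free v S → v ≡ a ⊎ v ≡ b → Star (ex ++ S) a b ws → length ws ≤ length ex
star-through {v} {ex} {S} {a} {b} {ws} free v≡ s = subst (length ws ≤_) (+-identityʳ _)
  (≤-trans lost (+-monoʳ-≤ (length ex) (none left)))
  where
  open Shrunk (star-suffix ex s)
  none : ∀ {ws} → Star S a b ws → length ws ≤ 0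
  none (star [] []) = z≤n
  none (star (_ ∷ _) ((i , _) ∷ _)) = ⊥-elim (free i ([ inj₁ , inj₂ ∘ inj₁ ]′ v≡))

pair-≡ : ∀ {a b c d v} → (a , b , v) ≈ (c , d , v) → a ≢ b → a ≢ v → b ≢ v →
         (a ≡ c × b ≡ d) ⊎ (a ≡ d × b ≡ c)
pair-≡ p a≢b a≢v b≢v with to p 1st | to p 2nd
... | inj₁ refl | inj₁ refl = ⊥-elim (a≢b refl)
... | inj₁ e | inj₂ (inj₁ f) = inj₁ (e , f)
... | inj₂ (inj₁ e) | inj₁ f = inj₂ (e , f)
... | inj₂ (inj₁ refl) | inj₂ (inj₁ refl) = ⊥-elim (a≢b refl)
... | inj₂ (inj₂ e) | _ = ⊥-elim (a≢v e)
... | _ | inj₂ (inj₂ e) = ⊥-elim (b≢v e)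

book-∷ : ∀ {S C X Y U v} → ¬ v ∈ C ∷ X ∷ Y ∷ U → E S C X v → E S C Y v → Book S C X Y U → Book S C X Y (v ∷ U)
book-∷ {U = U} {v} v∉ ex ey b = book
  ((C≢X ∷ C≢Y ∷ ≢-sym (v∉ ∘ here) ∷ C≢U) ∷ (X≢Y ∷ ≢-sym (v∉ ∘ there ∘ here) ∷ X≢U) ∷
   (≢-sym (v∉ ∘ there ∘ there ∘ here) ∷ Y≢U) ∷ All.tabulate (λ i e → v∉ (there (there (there (subst (_∈ U) (sym e) i))))) ∷ U!)
  spine (ex ∷ pageX) (ey ∷ pageY)
  where open Book b

free-book : ∀ {v S C X Y U} → Free v S → Book S C X Y U → ¬ v ∈ C ∷ X ∷ Y ∷ U
free-book free b = λ where
  (here refl) → free (Book.spine b) 1st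
  (there (here refl)) → free (Book.spine b) 2nd
  (there (there (here refl))) → free (Book.spine b) 3rd
  (there (there (there i))) → free (All.lookup (Book.pageX b) i) 3rd

-- Endless threats of P₂

-- The centre and one spine vertex of the core are a and b, in either order, because an edge abv
-- does not tell which of the two is the centre.
record CoreOn (S : List Triple) (a b : ℕ) : Set where
  constructor coreOn
  field
    {C X Y} : ℕ
    {U}     : List ℕ
    pair    : (C ≡ a × X ≡ b) ⊎ (C ≡ b × X ≡ a)
    enough  : 3 ≤ length U
    theBook : Book S C X Y U

-- Here f may already belong to P₁, so this also excludes a finished copy.
NoThreat : List Triple → List Triple → Set
NoThreat A B = ∀ {f} → ¬ f ∈ₑ B → ¬ Copy (f ∷ A)

module _ {s c x v M} (s≈ : (c , x , v) ≈ s) (free : Free v M) where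

  private
    v∈s : v ∈ᵛ s
    v∈s = to s≈ 3rd

  -- All edges at v come from `ex`, while the pairs CX and CY each lie in more edges than `ex` has.
  -- So v can only be a leaf.
  vertices≢ : ∀ {ex C X Y U} → length ex < length (Y ∷ U) → Book (ex ++ M) C X Y U → v ≢ C × v ≢ X × v ≢ Y
  vertices≢ {ex} {C} {X} {Y} {U} l b =
    (λ { refl → absurd (inj₁ refl) starX }) , (λ { refl → absurd (inj₂ refl) starX }) ,
    (λ { refl → absurd (inj₂ refl) (Book.starX (book-swap b)) })
    where
    open Book b
    absurd : ∀ {a b w} → v ≡ a ⊎ v ≡ b → Star (ex ++ M) a b (w ∷ U) → ⊥
    absurd v≡ st = <-irrefl refl (≤-trans l (star-through {ex = ex} free v≡ st))

  leaf-edges : ∀ {ex C X Y U} → v ∈ U → Book (ex ++ M) C X Y U → E ex C X v × E ex C Y v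
  leaf-edges v∈U b = through free 3rd (All.lookup pageX v∈U) , through free 3rd (All.lookup pageY v∈U)
    where open Book b

  -- As a leaf v would need two different edges, but only s passes through it; hence the core does
  -- not use s.
  noCore-∷ : ¬ CoreOn M c x → ¬ CoreOn (s ∷ M) c x
  noCore-∷ none (coreOn {C} {X} {Y} {U} pr l b) = none (coreOn pr l (book-restrict v∈s v∉ b))
    where
    v≢ = vertices≢ {ex = [ s ]} (s≤s (≤-trans (s≤s z≤n) l)) b
    v∉ : ¬ v ∈ C ∷ X ∷ Y ∷ U
    v∉ (here e) = proj₁ v≢ e
    v∉ (there (here e)) = proj₁ (proj₂ v≢) e
    v∉ (there (there (here e))) = proj₂ (proj₂ v≢) e
    v∉ (there (there (there v∈U))) with leaf-edges {ex = [ s ]} v∈U b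
    ... | here p , here q = X-page≉Y-page b (≢-sym (proj₁ (proj₂ v≢))) (≈-trans p (≈-sym q))

  noThreat-∷ : ∀ {B} → NoThreat M B → ¬ CoreOn M c x → NoThreat (s ∷ M) B
  noThreat-∷ nt none {f} f∉B (copy {C} {X} {Y} {u₁} {u₂} {u₃} {u₄} b) = cases (v ∈? U)
    where
    open Book b
    U = u₁ ∷ u₂ ∷ u₃ ∷ u₄ ∷ []
    v≢ = vertices≢ {ex = f ∷ s ∷ []} (s≤s (s≤s (s≤s z≤n))) b
    v≢C = proj₁ v≢
    v≢X = proj₁ (proj₂ v≢)
    v≢Y = proj₂ (proj₂ v≢)
    flip : ∀ {V} → Book (f ∷ s ∷ M) C X Y V → Book (s ∷ f ∷ M) C X Y V
    flip = book-map λ { (here p) → there (here p) ; (there (here p)) → here p ; (there (there i)) → there (there i) }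
    v∉ : ∀ {V} → ¬ v ∈ V → ¬ v ∈ C ∷ X ∷ Y ∷ V
    v∉ v∉V (here e) = v≢C e
    v∉ v∉V (there (here e)) = v≢X e
    v∉ v∉V (there (there (here e))) = v≢Y e
    v∉ v∉V (there (there (there i))) = v∉V i
    open Pruned (without v U!)
    inner : v ∈ᵛ f → Book M C X Y rest
    inner v∈f = book-restrict v∈f v∉′ (book-restrict v∈s v∉′ (flip (book-sub sub pairs b)))
      where
      v∉′ : ¬ v ∈ C ∷ X ∷ Y ∷ rest
      v∉′ = v∉ λ i → All.lookup all i refl
    cases : Dec (v ∈ U) → ⊥
    cases (no v∉U) = nt f∉B (copy (book-restrict v∈s (v∉ v∉U) (flip b)))
    cases (yes v∈U) with leaf-edges {ex = f ∷ s ∷ []} v∈U b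
    ... | here p , here q = X-page≉Y-page b (≢-sym v≢X) (≈-trans p (≈-sym q))
    ... | there (here p) , there (here q) = X-page≉Y-page b (≢-sym v≢X) (≈-trans p (≈-sym q))
    ... | there (here p) , here q =
      none (coreOn (pair-≡ (≈-trans p (≈-sym s≈)) C≢X (≢-sym v≢C) (≢-sym v≢X)) (≤-pred size) (inner (to q 3rd)))
    ... | here q , there (here p) =
      none (coreOn (pair-≡ (≈-trans p (≈-sym s≈)) C≢Y (≢-sym v≢C) (≢-sym v≢Y)) (≤-pred size)
                   (book-swap (inner (to q 3rd))))

module Chasing (σ₁ : Strategy) where
  open Game σ₁
  open Position

  module _ {c x y u₁ u₂ u₃ : ℕ} where

    private
      Core : List Triple → Set
      Core B = Book B c x y (u₁ ∷ u₂ ∷ u₃ ∷ [])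

    -- P₂ has just played cyv with v new and threatens cxv. The forced answer cxv has a vertex of degree one in P₁'s graph,
    -- so it brings her no closer to G unless she has a core with spine pair cx.
    record Chase (A B : List Triple) : Set where
      field
        {v}       : ℕ
        core      : Core B
        noThreat  : NoThreat A B
        noCore    : ¬ CoreOn A c x
        half      : E B c y v
        free      : Free v A
        open-edge : ¬ E B c x v
        v∉core    : ¬ v ∈ c ∷ x ∷ y ∷ u₁ ∷ u₂ ∷ u₃ ∷ []

    noThreat⇒noCopy : ∀ {r A B} → ¬ r ∈ₑ B → NoThreat (r ∷ A) B → ¬ Copy (r ∷ A)
    noThreat⇒noCopy r∉B nt = nt r∉B ∘ copy-map there

    extend : ∀ {A B} (P : Position A B) → Core B → NoThreat (reply P ∷ A) B → ¬ CoreOn (reply P ∷ A) c x →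
             Σ Triple λ m → Move P m × Chase (reply P ∷ A) (m ∷ B)
    extend {A} {B} P core nt nc = m , move , record
      { core = book-map there core
      ; noThreat = λ f∉ → nt (f∉ ∘ there)
      ; noCore = nc
      ; half = here m≈
      ; free = freeA
      ; open-edge = λ { (here p) → x∉ (to (≈-trans p (≈-sym m≈)) 2nd) ; (there i) → freeB i 3rd }
      ; v∉core = v∉ }
      where
      open Book core
      v = proj₁ (fresh (reply P ∷ A) B)
      freeA = proj₁ (proj₂ (fresh (reply P ∷ A) B))
      freeB = proj₂ (proj₂ (fresh (reply P ∷ A) B))
      v∉ = free-book freeB core
      new = edge {c} {y} {v} C≢Y (λ { refl → v∉ (here refl) }) (λ { refl → v∉ (there (there (here refl))) })
      m = proj₁ new
      m≈ = proj₂ (proj₂ new)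
      x∉ : ¬ x ∈ᵛ (c , y , v)
      x∉ 1st = C≢X refl
      x∉ 2nd = X≢Y refl
      x∉ 3rd = v∉ (there (here refl))
      move : Move P m
      move = record
        { noCopy = noThreat⇒noCopy (reply∉B P) nt
        ; board = proj₁ (proj₂ new)
        ; m∉A = λ i → freeA i (to m≈ 3rd)
        ; m∉B = λ i → freeB i (to m≈ 3rd) }

    answer : ∀ {A B} (P : Position A B) → Chase A B → Σ Triple λ m → Move P m × Chase (reply P ∷ A) (m ∷ B)
    answer {A} {B} P K with (c , x , Chase.v K) ≈? reply P
    ... | yes r≈ = extend P core (noThreat-∷ r≈ free noThreat noCore) (noCore-∷ r≈ free noCore)
      where open Chase K
    ... | no r≉ = ⊥-elim (lost (advance move) (copy (book-∷ v∉core (here m≈) (there half) (book-map there core))))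
      where
      open Chase K
      open Book core
      new = edge {c} {x} {v} C≢X (λ { refl → v∉core (here refl) }) (λ { refl → v∉core (there (here refl)) })
      m = proj₁ new
      m≈ = proj₂ (proj₂ new)
      move : Move P m
      move = record
        { noCopy = noThreat (reply∉B P)
        ; board = proj₁ (proj₂ new)
        ; m∉A = λ { (here p) → r≉ (≈-trans m≈ p) ; (there i) → free i (to m≈ 3rd) }
        ; m∉B = λ i → open-edge (∈ₑ-resp (≈-sym m≈) i) }

    chase₁ : ∀ {A B} (P : Position A B) → Core B → NoThreat (reply P ∷ A) B → ¬ ¬ CoreOn (reply P ∷ A) c x
    chase₁ P core nt nc with m , M , K ← extend P core nt nc = endless Chase answer (advance M) K

  -- A core is symmetric in x and y, so P₂ may force the answers on cx or on cy; each choice fails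
  -- only if P₁ has a core on that pair.
  chase : ∀ {A B c x y u₁ u₂ u₃} (P : Position A B) → Book B c x y (u₁ ∷ u₂ ∷ u₃ ∷ []) →
          NoThreat (reply P ∷ A) B → ¬ ¬ (CoreOn (reply P ∷ A) c x × CoreOn (reply P ∷ A) c y)
  chase P core nt ¬both =
    chase₁ P core nt λ k₁ → chase₁ P (book-swap core) nt λ k₂ → ¬both (k₁ , k₂)

two-labels : {P Q R : ℕ → Set} → (∀ {w w′} → w ≢ w′ → P w → P w′ → ⊥) → (∀ {w w′} → w ≢ w′ → Q w → Q w′ → ⊥) →
             ∀ {ws} → Unique ws → All (λ w → P w ⊎ Q w ⊎ R w) ws →
             Σ (List ℕ) λ vs → (∀ {v} → v ∈ vs → v ∈ ws) × Unique vs × All R vs × length ws ≤ 2 + length vs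
two-labels onceP onceQ ws! labels =
  N.rest , M.sub ∘ N.sub , N.pairs , N.all , ≤-trans M.size (s≤s N.size)
  where
  module M = Pruned (prune onceP ws! labels)
  module N = Pruned (prune onceQ M.pairs M.all)

escape : ∀ V {U : List ℕ} → Unique U → length V < length U → Σ ℕ λ u → u ∈ U × ¬ u ∈ V
escape [] {u ∷ U} _ _ = u , here refl , λ ()
escape (v ∷ V) U! l =
  let u , u∈ , u∉ = escape V pairs (≤-pred (≤-trans l size)) in
  u , sub u∈ , λ { (here u≡v) → All.lookup all u∈ u≡v ; (there i) → u∉ i }
  where
  open Pruned (without v U!)

-- Endless threats of P₁

-- P₁ can never make w a page on the spine κpq. That she has neither of its two edges is what
-- `not-exceptional` contradicts.
record Blocked (A B : List Triple) (κ p q w : ℕ) : Set where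
  constructor blocked
  field
    p∉ : ¬ E A κ p w
    q∉ : ¬ E A κ q w
    taken : E B κ p w ⊎ E B κ q w

-- All edges of P₁ contain κp or κq, except at most two. A pair other than κp and κq then lies in at most two of her edges,
-- unless it is contained in o₂ together with κ.
record Frame (A B : List Triple) (κ p q : ℕ) : Set where
  field
    κ≢p     : κ ≢ p
    κ≢q     : κ ≢ q
    p≢q     : p ≢ q
    {o₁ o₂} : Triple
    class   : ∀ {t} → t ∈ₑ A → (κ ∈ᵛ t × (p ∈ᵛ t ⊎ q ∈ᵛ t)) ⊎ t ≈ o₁ ⊎ t ≈ o₂
    linear  : ∀ {a b} → a ≢ b → a ∈ᵛ o₁ → b ∈ᵛ o₁ → a ∈ᵛ o₂ → b ∈ᵛ o₂ → o₁ ≈ o₂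
    κ∉o₁    : ¬ κ ∈ᵛ o₁
    κ∈o₂    : κ ∈ᵛ o₂ → Σ ℕ λ z → Σ ℕ λ w → (κ , z , w) ≈ o₂ × w ≢ p × w ≢ q × Blocked A B κ p q w

frame-swap : ∀ {A B κ p q} → Frame A B κ p q → Frame A B κ q p
frame-swap F = record
  { κ≢p = κ≢q ; κ≢q = κ≢p ; p≢q = ≢-sym p≢q
  ; class = λ i → [ (λ { (k , m) → inj₁ (k , [ inj₂ , inj₁ ]′ m) }) , inj₂ ]′ (class i)
  ; linear = linear ; κ∉o₁ = κ∉o₁
  ; κ∈o₂ = λ k → let z , w , e , w≢p , w≢q , blocked np nq t = κ∈o₂ k in
      z , w , e , w≢q , w≢p , blocked nq np ([ inj₂ , inj₁ ]′ t) }
  where open Frame F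

module _ {A B κ p q} (F : Frame A B κ p q) where
  open Frame F

  private
    label : ∀ {z w} → z ≢ p → z ≢ q → E A κ z w → w ≡ p ⊎ w ≡ q ⊎ (κ , z , w) ≈ o₂
    label z≢p z≢q i with class i
    ... | inj₁ (_ , inj₁ 1st) = ⊥-elim (κ≢p refl)
    ... | inj₁ (_ , inj₁ 2nd) = ⊥-elim (z≢p refl)
    ... | inj₁ (_ , inj₁ 3rd) = inj₁ refl
    ... | inj₁ (_ , inj₂ 1st) = ⊥-elim (κ≢q refl)
    ... | inj₁ (_ , inj₂ 2nd) = ⊥-elim (z≢q refl)
    ... | inj₁ (_ , inj₂ 3rd) = inj₂ (inj₁ refl)
    ... | inj₂ (inj₁ e) = ⊥-elim (κ∉o₁ (to e 1st))
    ... | inj₂ (inj₂ e) = inj₂ (inj₂ e)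

    Is : ℕ → ℕ → Set
    Is v w = w ≡ v
    Odd : ℕ → ℕ → Set
    Odd z w = (κ , z , w) ≈ o₂ × w ≢ κ × w ≢ z

    once : ∀ {v w w′} → w ≢ w′ → Is v w → Is v w′ → ⊥
    once w≢w′ refl refl = w≢w′ refl
    odd-once : ∀ {z w w′} → w ≢ w′ → Odd z w → Odd z w′ → ⊥
    odd-once w≢w′ (e , w≢κ , w≢z) (e′ , _) = w≢w′ (third-unique e e′ w≢κ w≢z)

    labels : ∀ {z ws} → z ≢ p → z ≢ q → Star A κ z ws → All (λ w → Is p w ⊎ Is q w ⊎ Odd z w) ws
    labels z≢p z≢q (star _ rays) = All.map
      (λ { (i , d) → [ inj₁ , [ inj₂ ∘ inj₁ , (λ e → inj₂ (inj₂ (e , d))) ]′ ]′ (label z≢p z≢q i) }) rays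

    star≤3 : ∀ {z ws} → z ≢ p → z ≢ q → Star A κ z ws → length ws ≤ 3
    star≤3 z≢p z≢q s@(star ws! _) with two-labels once once ws! (labels z≢p z≢q s)
    ... | [] , _ , _ , _ , l = ≤-trans l (s≤s (s≤s z≤n))
    ... | _ ∷ [] , _ , _ , _ , l = l
    ... | _ ∷ _ ∷ _ , _ , (w≢w′ ∷ _) ∷ _ , o ∷ o′ ∷ _ , _ = ⊥-elim (odd-once w≢w′ o o′)

    -- The only way for a pair κz off p and q to reach degree three: the third vertices are p, q and
    -- one supplied by o₂.
    record Exceptional (z : ℕ) (ws : List ℕ) : Set where
      field
        z≢p  : z ≢ p
        z≢q  : z ≢ q
        p-on : E A κ z p
        {w}  : ℕ
        w∈   : w ∈ ws
        odd  : Odd z w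

    rotate : ∀ {P Q R : Set} → P ⊎ Q ⊎ R → Q ⊎ R ⊎ P
    rotate (inj₁ p) = inj₂ (inj₂ p)
    rotate (inj₂ (inj₁ q)) = inj₁ q
    rotate (inj₂ (inj₂ r)) = inj₂ (inj₁ r)

    kind : ∀ {z ws} → Star A κ z ws → 3 ≤ length ws → z ≡ p ⊎ z ≡ q ⊎ Exceptional z ws
    kind {z} s@(star ws! rays) l with z ≟ p | z ≟ q
    ... | yes e | _ = inj₁ e
    ... | no _ | yes e = inj₂ (inj₁ e)
    ... | no z≢p | no z≢q
      with two-labels once once ws! (labels z≢p z≢q s)
         | two-labels once odd-once ws! (All.map rotate (labels z≢p z≢q s))
    ... | [] , _ , _ , _ , l′ | _ = ⊥-elim (<-irrefl refl (≤-trans l l′))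
    ... | _ | [] , _ , _ , _ , l′ = ⊥-elim (<-irrefl refl (≤-trans l l′))
    ... | _ ∷ _ , sub , _ , o ∷ _ , _ | _ ∷ _ , sub′ , _ , refl ∷ _ , _ = inj₂ (inj₂ (record
      { z≢p = z≢p ; z≢q = z≢q ; p-on = proj₁ (All.lookup rays (sub′ (here refl)))
      ; w∈ = sub (here refl) ; odd = o }))

    -- The third vertex is κ or comes from o₁ or o₂; by `linear` these two contain a common pair
    -- only if they coincide. So the degree is at most two.
    star∌κ : ∀ {a b ws} → a ≢ κ → b ≢ κ → a ≢ b → Star A a b ws → ¬ 3 ≤ length ws
    star∌κ {a} {b} {ws} a≢κ b≢κ a≢b (star ws! rays) l = go (≤-pred (≤-trans l size)) pairs all
      where
      Off : ℕ → Set
      Off w = ((a , b , w) ≈ o₁ ⊎ (a , b , w) ≈ o₂) × w ≢ a × w ≢ b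
      label′ : ∀ {w} → E A a b w × w ≢ a × w ≢ b → Is κ w ⊎ Off w
      label′ (i , d) with class i
      ... | inj₁ (1st , _) = ⊥-elim (a≢κ refl)
      ... | inj₁ (2nd , _) = ⊥-elim (b≢κ refl)
      ... | inj₁ (3rd , _) = inj₁ refl
      ... | inj₂ o = inj₂ (o , d)
      open Pruned (prune once ws! (All.map label′ rays))
      o₁≈o₂ : ∀ {w w′} → (a , b , w) ≈ o₁ → (a , b , w′) ≈ o₂ → o₁ ≈ o₂
      o₁≈o₂ e e′ = linear a≢b (to e 1st) (to e 2nd) (to e′ 1st) (to e′ 2nd)
      off-once : ∀ {w w′} → Off w → Off w′ → w ≡ w′
      off-once (inj₁ e , w≢a , w≢b) (inj₁ e′ , _) = third-unique e e′ w≢a w≢b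
      off-once (inj₁ e , w≢a , w≢b) (inj₂ e′ , _) = third-unique e (≈-trans e′ (≈-sym (o₁≈o₂ e e′))) w≢a w≢b
      off-once (inj₂ e , w≢a , w≢b) (inj₁ e′ , _) = third-unique e (≈-trans e′ (o₁≈o₂ e′ e)) w≢a w≢b
      off-once (inj₂ e , w≢a , w≢b) (inj₂ e′ , _) = third-unique e e′ w≢a w≢b
      go : ∀ {vs} → 2 ≤ length vs → Unique vs → All Off vs → ⊥
      go {_ ∷ []} (s≤s ()) _ _
      go {_ ∷ _ ∷ _} _ ((w≢w′ ∷ _) ∷ _) (o ∷ o′ ∷ _) = w≢w′ (off-once o o′)

    -- Used with m extra edges, n pages and k surviving leaves: j = 1 gives degree three in `A`, and
    -- j = 2 gives degree four when some extra edge misses the pair.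
    enough : ∀ j {m n k} → 2 + m ≤ n → j + n ≤ m + k → 2 + j ≤ k
    enough j {m} {n} {k} l l′ = +-cancelˡ-≤ m (2 + j) k (subst (_≤ m + k) (sym m+2+j) (≤-trans (+-monoʳ-≤ j l) l′))
      where
      m+2+j : m + (2 + j) ≡ j + (2 + m)
      m+2+j = trans (+-comm m (2 + j)) (sym (trans (+-suc j (suc m)) (cong suc (+-suc j m))))

    module _ {ex : List Triple} where

      shrink : ∀ {C X Y U} → 2 + length ex ≤ length U → Book (ex ++ A) C X Y U →
               Σ (List ℕ) λ ws → (∀ {w} → w ∈ ws → w ∈ Y ∷ U) × Star A C X ws × 3 ≤ length ws
      shrink l b = kept , kept⊆ , left , enough 1 l lost
        where open Shrunk (star-suffix ex (Book.starX b))

      -- If o₂ raises the degree of κX to three, the edges ex are all used up at κX, so that κYw ∈ A for its third vertex w,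
      -- although w is blocked.
      not-exceptional : ∀ {X Y U ws vs} → 2 + length ex ≤ length U → Book (ex ++ A) κ X Y U →
                        (∀ {w} → w ∈ ws → w ∈ Y ∷ U) → Exceptional X ws → ¬ (Y ≡ p ⊎ Y ≡ q ⊎ Exceptional Y vs)
      not-exceptional {X} {Y} {U} l b ws⊆ ε κY with κ∈o₂ (to (proj₁ (Exceptional.odd ε)) 1st)
      ... | z , w , e , w≢p , w≢q , blocked np nq _ = X-cases κY (from e (to (proj₁ odd) 2nd))
        where
        open Exceptional ε using (z≢p; z≢q; p-on; odd; w∈)
        open Book b
        no-w-p : ¬ E A κ w p
        no-w-p i = np (E₂₃ i)
        at-w : X ≡ z → w ∈ U → Y ≡ p ⊎ Y ≡ q → ⊥
        at-w refl w∈U Y≡ with Anyₚ.++⁻ ex (All.lookup pageY w∈U)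
        ... | inj₂ i = [ (λ { refl → np i }) , (λ { refl → nq i }) ]′ Y≡
        ... | inj₁ i =
          let vs , s , l′ = star-suffix′ ex (Any.map avoids i) starX in
          <-irrefl refl (≤-trans (enough 2 l l′) (star≤3 z≢p z≢q s))
          where
          avoids : ∀ {x} → (κ , Y , w) ≈ x → ∀ v → ¬ (κ , X , v) ≈ x
          avoids p v r with from p (to r 2nd)
          ... | 1st = C≢X refl
          ... | 2nd = X≢Y refl
          ... | 3rd = All.lookup X≢U w∈U refl
        X-cases : ∀ {vs} → Y ≡ p ⊎ Y ≡ q ⊎ Exceptional Y vs → X ∈ᵛ (κ , z , w) → ⊥
        X-cases _ 1st = C≢X refl
        X-cases _ 3rd = no-w-p p-on
        X-cases κY 2nd with third-unique (proj₁ odd) e (proj₁ (proj₂ odd)) (proj₂ (proj₂ odd))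
        ... | refl with ws⊆ w∈ | κY
        ...   | here refl | inj₁ e′ = w≢p e′
        ...   | here refl | inj₂ (inj₁ e′) = w≢q e′
        ...   | here refl | inj₂ (inj₂ ε′) = no-w-p (Exceptional.p-on ε′)
        ...   | there i | inj₁ e′ = at-w refl i (inj₁ e′)
        ...   | there i | inj₂ (inj₁ e′) = at-w refl i (inj₂ e′)
        ...   | there i | inj₂ (inj₂ ε′) with from e (to (proj₁ (Exceptional.odd ε′)) 2nd)
        ...     | 1st = C≢Y refl
        ...     | 2nd = X≢Y refl
        ...     | 3rd = no-w-p (Exceptional.p-on ε′)

  -- In a book in ex ++ A the pairs CX and CY lie in at least three edges of A each.
  frame-unique : ∀ {ex C X Y U} → 2 + length ex ≤ length U → Book (ex ++ A) C X Y U →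
                 C ≡ κ × ((X ≡ p × Y ≡ q) ⊎ (X ≡ q × Y ≡ p))
  frame-unique {ex} {C} {X} {Y} l b with C ≟ κ
  ... | no C≢κ with X ≟ κ
  ...   | no X≢κ = let _ , _ , s , l′ = shrink l b in ⊥-elim (star∌κ C≢κ X≢κ C≢X s l′)
    where open Book b
  ...   | yes refl = let _ , _ , s , l′ = shrink l (book-swap b) in
                     ⊥-elim (star∌κ C≢κ (≢-sym X≢Y) C≢Y s l′)
    where open Book b
  frame-unique {ex} {C} {X} {Y} l b | yes refl with shrink l b | shrink l (book-swap b)
  ... | _ , sub , s , l′ | _ , sub′ , s′ , l″ with kind s l′ | kind s′ l″
  ...   | inj₁ refl | inj₁ refl = ⊥-elim (Book.X≢Y b refl)
  ...   | inj₁ e | inj₂ (inj₁ e′) = refl , inj₁ (e , e′)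
  ...   | inj₂ (inj₁ e) | inj₁ e′ = refl , inj₂ (e , e′)
  ...   | inj₂ (inj₁ refl) | inj₂ (inj₁ refl) = ⊥-elim (Book.X≢Y b refl)
  ...   | inj₂ (inj₂ ε) | k = ⊥-elim (not-exceptional l b sub ε k)
  ...   | k | inj₂ (inj₂ ε) = ⊥-elim (not-exceptional l (book-swap b) sub′ ε k)

-- P₂ answers κpw by κqw and vice versa. Either the spine κpq is his, or P₁ has at most three complete pages.
record Pairing (A B : List Triple) (κ p q : ℕ) : Set where
  field
    frame  : Frame A B κ p q
    closed : E B κ p q ⊎ Σ (List ℕ) λ V → length V ≤ 3 ×
               (∀ w → w ≢ κ → w ≢ p → w ≢ q → ¬ w ∈ V → (E A κ p w → E B κ q w) × (E A κ q w → E B κ p w))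

pairing-swap : ∀ {A B κ p q} → Pairing A B κ p q → Pairing A B κ q p
pairing-swap P = record
  { frame = frame-swap frame
  ; closed = [ inj₁ ∘ E₂₃ , (λ { (V , l , c) → inj₂ (V , l , λ w w≢κ w≢q w≢p w∉ → swap (c w w≢κ w≢p w≢q w∉)) }) ]′ closed }
  where open Pairing P

record Partners (κ p q : ℕ) (e f : Triple) : Set where
  field
    {w}  : ℕ
    w≢κ  : w ≢ κ
    w≢p  : w ≢ p
    w≢q  : w ≢ q
    p-edge : (κ , p , w) ≈ e
    q-edge : (κ , q , w) ≈ f

-- One of the four leaves lies outside the three exceptions in `closed`. If `A` had one of its two
-- edges, P₂ would have the other; so both must be among e and f.
paired : ∀ {A B κ p q e f U} → Pairing A B κ p q → (∀ {t} → t ∈ₑ e ∷ f ∷ A → ¬ t ∈ₑ B) →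
         4 ≤ length U → Book (e ∷ f ∷ A) κ p q U → Partners κ p q e f ⊎ Partners κ q p e f
paired P live 4≤ b with Pairing.closed P
... | inj₁ i = ⊥-elim (live (Book.spine b) i)
... | inj₂ (V , l , c) with escape V (Book.U! b) (≤-trans (s≤s l) 4≤)
...   | u , u∈ , u∉ with u≢κ , u≢p , u≢q ← Book.leaf≢ b u∈
        with All.lookup (Book.pageX b) u∈ | All.lookup (Book.pageY b) u∈
...     | there (there i) | j = ⊥-elim (live j (proj₁ (c u u≢κ u≢p u≢q u∉) i))
...     | i | there (there j) = ⊥-elim (live i (proj₂ (c u u≢κ u≢p u≢q u∉) j))
...     | here i | here j = ⊥-elim (X-page≉Y-page b (≢-sym u≢p) (≈-trans i (≈-sym j)))
...     | there (here i) | there (here j) = ⊥-elim (X-page≉Y-page b (≢-sym u≢p) (≈-trans i (≈-sym j)))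
...     | here i | there (here j) = inj₁ (record
          { w≢κ = u≢κ ; w≢p = u≢p ; w≢q = u≢q ; p-edge = i ; q-edge = j })
...     | there (here i) | here j = inj₂ (record
          { w≢κ = u≢κ ; w≢p = u≢q ; w≢q = u≢p ; p-edge = j ; q-edge = i })

threats-paired : ∀ {A B κ p q e f} → Pairing A B κ p q → (∀ {t} → t ∈ₑ e ∷ f ∷ A → ¬ t ∈ₑ B) →
                 Copy (e ∷ f ∷ A) → Partners κ p q e f ⊎ Partners κ q p e f
threats-paired {A} {B} {κ} {p} {q} {e} {f} P live (copy {C} {X} {Y} {u₁} {u₂} {u₃} {u₄} b)
  with frame-unique (Pairing.frame P) {ex = e ∷ f ∷ []} ≤-refl b
... | refl , inj₁ (refl , refl) = paired P live ≤-refl b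
... | refl , inj₂ (refl , refl) = paired P live ≤-refl (book-swap b)

∃ᵛ? : ∀ {P : ℕ → Set} → (∀ w → Dec (P w)) → ∀ t → Dec (Σ ℕ λ w → w ∈ᵛ t × P w)
∃ᵛ? P? (a , b , c) = map′
  (λ { (inj₁ p) → a , 1st , p ; (inj₂ (inj₁ p)) → b , 2nd , p ; (inj₂ (inj₂ p)) → c , 3rd , p })
  (λ { (_ , 1st , p) → inj₁ p ; (_ , 2nd , p) → inj₂ (inj₁ p) ; (_ , 3rd , p) → inj₂ (inj₂ p) })
  (P? a ⊎-dec P? b ⊎-dec P? c)

module PairingPlay (σ₁ : Strategy) where
  open Game σ₁
  open Position
  open Chasing σ₁

  module _ {κ p q c x y u₁ u₂ u₃ : ℕ} where

    private
      Core : List Triple → Set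
      Core B = Book B c x y (u₁ ∷ u₂ ∷ u₃ ∷ [])

      Answer : ∀ {A B} → Position A B → ℕ → ℕ → Set
      Answer {A} {B} P p q = Σ Triple λ m → Move P m × Pairing (reply P ∷ A) (m ∷ B) κ p q

    -- The replies that P₂ answers by pairing: κpw with its partner κqw still uncoloured.
    Mate : List Triple → List Triple → ℕ → ℕ → Triple → ℕ → Set
    Mate A B p q r w = (κ , p , w) ≈ r × w ≢ κ × w ≢ p × w ≢ q × ¬ E A κ q w × ¬ E B κ q w

    mate? : ∀ A B p q r w → Dec (Mate A B p q r w)
    mate? A B p q r w = ((κ , p , w) ≈? r) ×-dec ¬? (w ≟ κ) ×-dec ¬? (w ≟ p) ×-dec ¬? (w ≟ q)
      ×-dec ¬? ((κ , q , w) ∈ₑ? A) ×-dec ¬? ((κ , q , w) ∈ₑ? B)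

    absurd : ∀ {p q e} → κ ≢ p → p ≢ q → ¬ Partners κ p q e e
    absurd κ≢p p≢q N with from (Partners.q-edge N) (to (Partners.p-edge N) 2nd)
    ... | 1st = κ≢p refl
    ... | 2nd = p≢q refl
    ... | 3rd = Partners.w≢p N refl

    no-copy : ∀ {A B p q} (P : Position A B) → Pairing A B κ p q → ¬ Copy (reply P ∷ A)
    -- The single reply is counted twice as a double threat; it would then have to be κpw and κqw at
    -- once.
    no-copy P I k with threats-paired I (λ { (here e) → disjoint′ P (here e) ; (there i) → disjoint′ P i }) (copy-map there k)
    ... | inj₁ N = absurd (Frame.κ≢p (Pairing.frame I)) (Frame.p≢q (Pairing.frame I)) N
    ... | inj₂ N = absurd (Frame.κ≢q (Pairing.frame I)) (≢-sym (Frame.p≢q (Pairing.frame I))) N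

    mate-answer : ∀ {A B p q w} (P : Position A B) → Pairing A B κ p q → Mate A B p q (reply P) w → Answer P p q
    mate-answer {A} {B} {p} {q} {w} P I (r≈ , w≢κ , w≢p , w≢q , ∉A , ∉B) = m , move , record
      { frame = record
        { κ≢p = κ≢p ; κ≢q = κ≢q ; p≢q = p≢q
        ; class = λ { (here e) → inj₁ (from e (to r≈ 1st) , inj₁ (from e (to r≈ 2nd))) ; (there i) → class i }
        ; linear = linear ; κ∉o₁ = κ∉o₁
        ; κ∈o₂ = λ k → let z , w′ , e , w′≢p , w′≢q , bl = κ∈o₂ k in z , w′ , e , w′≢p , w′≢q , still bl }
      ; closed = [ inj₁ ∘ there , (λ { (V , l , c) → inj₂ (V , l , λ w′ w′≢κ w′≢p w′≢q w′∉ →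
          (λ { (here e) → here (subst (λ w → (κ , q , w) ≈ m) (only e) m≈)
             ; (there i) → there (proj₁ (c w′ w′≢κ w′≢p w′≢q w′∉) i) }) ,
          (λ { (here e) → ⊥-elim (q∉r e) ; (there i) → there (proj₂ (c w′ w′≢κ w′≢p w′≢q w′∉) i) })) }) ]′ closed }
      where
      open Pairing I
      open Frame frame
      new = edge {κ} {q} {w} κ≢q (≢-sym w≢κ) (≢-sym w≢q)
      m = proj₁ new
      m≈ = proj₂ (proj₂ new)
      q∉r : ∀ {w′} → ¬ (κ , q , w′) ≈ reply P
      q∉r e with from r≈ (to e 2nd)
      ... | 1st = κ≢q refl
      ... | 2nd = p≢q refl
      ... | 3rd = w≢q refl
      only : ∀ {w′} → (κ , p , w′) ≈ reply P → w ≡ w′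
      only e = third-unique r≈ e w≢κ w≢p
      move : Move P m
      move = record
        { noCopy = no-copy P I
        ; board = proj₁ (proj₂ new)
        ; m∉A = λ { (here e) → q∉r (≈-trans m≈ e) ; (there i) → ∉A (∈ₑ-resp (≈-sym m≈) i) }
        ; m∉B = λ i → ∉B (∈ₑ-resp (≈-sym m≈) i) }
      -- P₂ owns one of the two edges at a blocked vertex, so the reply, which belongs to a pair not
      -- yet touched, is not at that vertex.
      still : ∀ {w′} → Blocked A B κ p q w′ → Blocked (reply P ∷ A) (m ∷ B) κ p q w′
      still (blocked np nq t) = blocked
        (λ { (here e) → [ (λ i → reply∉B P (∈ₑ-resp e i)) , (λ i → ∉B (subst (E B κ q) (sym (only e)) i)) ]′ t
           ; (there i) → np i })
        (λ { (here e) → q∉r e ; (there i) → nq i })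
        ([ inj₁ ∘ there , inj₂ ∘ there ]′ t)

    pairing-answer : ∀ {A B} (P : Position A B) → Pairing A B κ p q × Core B →
             Σ Triple λ m → Move P m × Pairing (reply P ∷ A) (m ∷ B) κ p q × Core (m ∷ B)
    pairing-answer {A} {B} P (I , core)
      with ∃ᵛ? (mate? A B p q (reply P)) (reply P) | ∃ᵛ? (mate? A B q p (reply P)) (reply P)
    ... | yes (w , _ , mate) | _ =
      let m , M , I′ = mate-answer P I mate in m , M , I′ , book-map there core
    ... | no _ | yes (w , _ , mate) =
      let m , M , I′ = mate-answer P (pairing-swap I) mate in m , M , pairing-swap I′ , book-map there core
    -- A reply outside the uncoloured pairs threatens nothing, so P₂ can start his chase. By
    -- `frame-unique` her cores on cx and cy would both have centre κ and spine vertices p, q; then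
    -- κpq is cxy, which P₂ owns.
    ... | no ¬p | no ¬q = ⊥-elim (chase P core noThreat λ { (k₁ , k₂) → cores k₁ k₂ })
      where
      open Pairing I
      noThreat : NoThreat (reply P ∷ A) B
      noThreat {f} f∉B k with threats-paired I (λ { (here e) i → f∉B (∈ₑ-resp e i) ; (there i) → disjoint′ P i }) k
      ... | inj₁ N = ¬q (w , to q-edge 3rd , q-edge , w≢κ , w≢q , w≢p , f∉A , λ i → f∉B (∈ₑ-resp p-edge i))
        where
        open Partners N
        f∉A : ¬ E A κ p w
        f∉A i = no-copy P I (copy-map (λ { (here e) → there (∈ₑ-resp (≈-trans p-edge (≈-sym e)) i) ; (there j) → j }) k)
      ... | inj₂ N = ¬p (w , to q-edge 3rd , q-edge , w≢κ , w≢q , w≢p , f∉A , λ i → f∉B (∈ₑ-resp p-edge i))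
        where
        open Partners N
        f∉A : ¬ E A κ q w
        f∉A i = no-copy P I (copy-map (λ { (here e) → there (∈ₑ-resp (≈-trans p-edge (≈-sym e)) i) ; (there j) → j }) k)
      open Book core using (C≢X; C≢Y; X≢Y; spine)
      cores : CoreOn (reply P ∷ A) c x → CoreOn (reply P ∷ A) c y → ⊥
      cores (coreOn pr l b) (coreOn pr′ l′ b′)
        with frame-unique frame {ex = [ reply P ]} l b | frame-unique frame {ex = [ reply P ]} l′ b′ | pr | pr′
      ... | refl , _ | refl , _ | inj₁ (refl , refl) | inj₂ (e , _) = C≢Y e
      ... | refl , _ | refl , _ | inj₂ (refl , refl) | inj₁ (e , _) = C≢X (sym e)
      ... | refl , _ | refl , _ | inj₂ (refl , refl) | inj₂ (e , _) = X≢Y e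
      ... | refl , inj₁ (refl , refl) | refl , inj₁ (refl , _) | inj₁ (refl , refl) | inj₁ (_ , refl) = X≢Y refl
      ... | refl , inj₁ (refl , refl) | refl , inj₂ (refl , _) | inj₁ (refl , refl) | inj₁ (_ , refl) = disjoint′ P (Book.spine b) spine
      ... | refl , inj₂ (refl , refl) | refl , inj₁ (refl , _) | inj₁ (refl , refl) | inj₁ (_ , refl) = disjoint′ P (Book.spine b) spine
      ... | refl , inj₂ (refl , refl) | refl , inj₂ (refl , _) | inj₁ (refl , refl) | inj₁ (_ , refl) = X≢Y refl

    pairing-draws : ∀ {A B} → Position A B → Pairing A B κ p q → ¬ Core B
    pairing-draws P I core = endless (λ A B → Pairing A B κ p q × Core B) pairing-answer P (I , core)

-- Positions where P₂ has a core

bookEdge-view : ∀ {t C X Y U} → t ∈ₑ bookEdges C X Y U →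
  t ≈ (C , X , Y) ⊎ Σ ℕ λ u → u ∈ U × (t ≈ (C , X , u) ⊎ t ≈ (C , Y , u))
bookEdge-view (here p) = inj₁ p
bookEdge-view {U = U} (there i) with Anyₚ.++⁻ (map _ U) i
... | inj₁ j = let u , u∈ , p = find (Anyₚ.map⁻ j) in inj₂ (u , u∈ , inj₁ p)
... | inj₂ j = let u , u∈ , p = find (Anyₚ.map⁻ j) in inj₂ (u , u∈ , inj₂ p)

center : ∀ {t C X Y U} → t ∈ₑ bookEdges C X Y U → C ∈ᵛ t
center {U = U} i with bookEdge-view {U = U} i
... | inj₁ p = from p 1st
... | inj₂ (_ , _ , inj₁ p) = from p 1st
... | inj₂ (_ , _ , inj₂ p) = from p 1st

hub : ∀ {t C X Y U} → t ∈ₑ bookEdges C X Y U → X ∈ᵛ t ⊎ Y ∈ᵛ t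
hub {U = U} i with bookEdge-view {U = U} i
... | inj₁ p = inj₁ (from p 2nd)
... | inj₂ (_ , _ , inj₁ p) = inj₁ (from p 2nd)
... | inj₂ (_ , _ , inj₂ p) = inj₂ (from p 2nd)

vertices : ∀ {t C X Y U v} → t ∈ₑ bookEdges C X Y U → v ∈ᵛ t → v ∈ C ∷ X ∷ Y ∷ U
vertices {U = U} i v∈ with bookEdge-view {U = U} i
... | inj₁ p with to p v∈
...   | 1st = here refl
...   | 2nd = there (here refl)
...   | 3rd = there (there (here refl))
vertices i v∈ | inj₂ (_ , u∈ , inj₁ p) with to p v∈
...   | 1st = here refl
...   | 2nd = there (here refl)
...   | 3rd = there (there (there u∈))
vertices i v∈ | inj₂ (_ , u∈ , inj₂ p) with to p v∈
...   | 1st = here refl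
...   | 2nd = there (there (here refl))
...   | 3rd = there (there (there u∈))

bookEdges-swap : ∀ {t C X Y} U → t ∈ₑ bookEdges C X Y U → t ∈ₑ bookEdges C Y X U
bookEdges-swap U (here e) = here (≈-trans e swap₂₃)
bookEdges-swap U (there i) = there ([ Anyₚ.++⁺ʳ _ , Anyₚ.++⁺ˡ ]′ (Anyₚ.++⁻ (map _ U) i))

length-bookEdges : ∀ {C X Y} U → length (bookEdges C X Y U) ≡ suc (length U + length U)
length-bookEdges U = cong suc (trans (length-++ (map _ U)) (cong₂ _+_ (length-map _ U) (length-map _ U)))

count : ∀ {S C X Y U} os → Book S C X Y U → Different os → All (_∈ₑ S) os →
        All (λ o → ¬ o ∈ₑ bookEdges C X Y U) os → suc (length U + length U) + length os ≤ length S
count {S} {C} {X} {Y} {U} os b os! os∈ os∉ = subst (_≤ length S)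
  (trans (length-++ (bookEdges C X Y U)) (cong (_+ length os) (length-bookEdges U)))
  (pigeonhole S (AllPairsₚ.++⁺ (bookEdges-different b) os! cross) (Allₚ.++⁺ (bookEdges∈ b) os∈))
  where
  cross : All (λ e → All (λ o → ¬ e ≈ o) os) (bookEdges C X Y U)
  cross = All.tabulate λ i → All.map (λ o∉ e≈o → o∉ (∈ₑ-resp e≈o (∈⇒∈ₑ i))) os∉

others : ∀ {U : List ℕ} {u} → u ∈ U → Σ (List ℕ) λ V → suc (length V) ≡ length U × (∀ {w} → w ∈ U → w ≡ u ⊎ w ∈ V)
others {_ ∷ U} (here refl) = U , refl , λ { (here e) → inj₁ e ; (there i) → inj₂ i }
others {u′ ∷ U} (there i) = let V , l , c = others i in
  u′ ∷ V , cong suc l , λ { (here e) → inj₂ (here e) ; (there j) → [ inj₁ , inj₂ ∘ there ]′ (c j) }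

-- The edges of P₁ outside the copy of G she threatens to complete.
record Wasted (A B : List Triple) (κ p q : ℕ) (U : List ℕ) : Set where
  field
    {o₁ o₂} : Triple
    class   : ∀ {t} → t ∈ₑ A → t ∈ₑ bookEdges κ p q U ⊎ t ≈ o₁ ⊎ t ≈ o₂
    linear  : ∀ {a b} → a ≢ b → a ∈ᵛ o₁ → b ∈ᵛ o₁ → a ∈ᵛ o₂ → b ∈ᵛ o₂ → o₁ ≈ o₂
    κ∉o₁    : ¬ κ ∈ᵛ o₁
    κ∈o₂    : κ ∈ᵛ o₂ → ¬ p ∈ᵛ o₂ × ¬ q ∈ᵛ o₂ ×
                Σ ℕ λ z → Σ ℕ λ w → (κ , z , w) ≈ o₂ × Blocked A B κ p q w

wasted-swap : ∀ {A B κ p q U} → Wasted A B κ p q U → Wasted A B κ q p U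
wasted-swap {U = U} W = record
  { class = λ i → [ inj₁ ∘ bookEdges-swap U , inj₂ ]′ (class i)
  ; linear = linear ; κ∉o₁ = κ∉o₁
  ; κ∈o₂ = λ k → let p∉ , q∉ , z , w , e , blocked a b t = κ∈o₂ k in
      q∉ , p∉ , z , w , e , blocked b a ([ inj₂ , inj₁ ]′ t) }
  where open Wasted W

Live : List Triple → List Triple → Set
Live S B = ∀ {t} → t ∈ₑ S → ¬ t ∈ₑ B

-- P₁ has blocked twice around the centre g: the pairs ab and yv of the link of g are hers, ya, yb and av are P₂'s.
-- Both blocks avoid her edge e.
record Blocks (A B : List Triple) (e : Triple) (g a b y v : ℕ) : Set where
  field
    g≢a : g ≢ a
    g≢y : g ≢ y
    a≢y : a ≢ y
    a≢v : a ≢ v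
    b≢y : b ≢ y
    b≢v : b ≢ v
    ab  : E A g a b
    yv  : E A g y v
    ya  : E B g y a
    yb  : E B g y b
    av  : E B g a v
    e∈  : e ∈ₑ A
    e∌ab : ∀ {w} → w ∈ᵛ (g , a , b) → ¬ w ∈ᵛ e
    e∌yv : ∀ {w} → w ∈ᵛ (g , y , v) → ¬ w ∈ᵛ e

  centre≡g : ∀ {κ} → κ ∈ᵛ (g , a , b) → κ ∈ᵛ (g , y , v) → κ ≡ g
  centre≡g 1st _ = refl
  centre≡g 2nd 1st = refl
  centre≡g 2nd 2nd = ⊥-elim (a≢y refl)
  centre≡g 2nd 3rd = ⊥-elim (a≢v refl)
  centre≡g 3rd 1st = refl
  centre≡g 3rd 2nd = ⊥-elim (b≢y refl)
  centre≡g 3rd 3rd = ⊥-elim (b≢v refl)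

  e≉ab : ¬ e ≈ (g , a , b)
  e≉ab p = e∌ab 1st (from p 1st)

  e≉yv : ¬ e ≈ (g , y , v)
  e≉yv p = e∌yv 1st (from p 1st)

  ab≉yv : ¬ (g , a , b) ≈ (g , y , v)
  ab≉yv p = g≢a (sym (centre≡g 2nd (to p 2nd)))

blocks-swap : ∀ {A B e g a b y v} → Blocks A B e g a b y v → Blocks A B e g y v a b
blocks-swap D = record
  { g≢a = g≢y ; g≢y = g≢a
  ; a≢y = ≢-sym a≢y ; a≢v = ≢-sym b≢y ; b≢y = ≢-sym a≢v ; b≢v = ≢-sym b≢v
  ; ab = yv ; yv = ab ; ya = E₂₃ ya ; yb = av ; av = yb
  ; e∈ = e∈ ; e∌ab = e∌yv ; e∌yv = e∌ab }
  where open Blocks D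

-- A spine vertex X forms an edge with the centre and every other vertex of the book.
off-book : ∀ {S B C X Y U w} → Live S B → Book S C X Y U → E B C X w → w ≢ C → w ≢ X → ¬ w ∈ C ∷ X ∷ Y ∷ U
off-book l b i w≢C w≢X (here e) = w≢C e
off-book l b i w≢C w≢X (there (here e)) = w≢X e
off-book l b i w≢C w≢X (there (there (here refl))) = l (Book.spine b) i
off-book l b i w≢C w≢X (there (there (there j))) = l (All.lookup (Book.pageX b) j) i

module _ {A B e g a b y v} (D : Blocks A B e g a b y v) where
  open Blocks D

  -- The centre would be g, the only common vertex of the blocks, and a or b would be a spine
  -- vertex. But y would also be in the book, although gya and gyb belong to P₂.
  not-both : ∀ {S C X Y U} → Live S B → Book S C X Y U → (g , a , b) ∈ₑ bookEdges C X Y U →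
             ¬ (g , y , v) ∈ₑ bookEdges C X Y U
  not-both {S} {C} {X} {Y} {U} lv bk i j with centre≡g (center {U = U} i) (center {U = U} j)
  ... | refl = [ (λ h → dead bk h j) , (λ h → dead (book-swap bk) h (bookEdges-swap U j)) ]′ (hub {U = U} i)
    where
    dead : ∀ {X Y} → Book S g X Y U → X ∈ᵛ (g , a , b) → ¬ (g , y , v) ∈ₑ bookEdges g X Y U
    dead bk 1st j = Book.C≢X bk refl
    dead bk 2nd j = off-book lv bk (E₂₃ ya) (≢-sym g≢y) (≢-sym a≢y) (vertices {U = U} j 2nd)
    dead bk 3rd j = off-book lv bk (E₂₃ yb) (≢-sym g≢y) (≢-sym b≢y) (vertices {U = U} j 2nd)

  data Spares (In : Triple → Set) : Set where
    both-blocks : In e → ¬ In (g , a , b) → ¬ In (g , y , v) → Spares In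
    e-and-ab    : ¬ In e → ¬ In (g , a , b) → Spares In
    e-and-yv    : ¬ In e → ¬ In (g , y , v) → Spares In

  -- A copy through e has its centre in e and so avoids both blocks; a copy without e contains at
  -- most one of them. Two of these three edges are always wasted.
  spares : ∀ {S C X Y U} → Live S B → Book S C X Y U → Spares (_∈ₑ bookEdges C X Y U)
  spares {C = C} {X} {Y} {U} lv bk
    with e ∈ₑ? bookEdges C X Y U | (g , a , b) ∈ₑ? bookEdges C X Y U
  ... | yes i | _ = both-blocks i (λ j → e∌ab (center {U = U} j) (center {U = U} i))
                                  (λ j → e∌yv (center {U = U} j) (center {U = U} i))
  ... | no e∉ | no n = e-and-ab e∉ n
  ... | no e∉ | yes i = e-and-yv e∉ (not-both lv bk i)

module Ending (σ₁ : Strategy) where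
  open Game σ₁
  open Position
  open Chasing σ₁
  open PairingPlay σ₁

  blocks-noCopy : ∀ {A B e g a b y v} (P : Position A B) → Blocks A B e g a b y v → length A ≤ 9 → ¬ Copy (reply P ∷ A)
  blocks-noCopy P D l (copy bk) with spares D (disjoint′ P) bk
  ... | both-blocks _ n n′ = 1+n≰n (≤-trans (count (_ ∷ _ ∷ []) bk ((ab≉yv ∷ []) ∷ [] ∷ [])
          (there ab ∷ there yv ∷ []) (n ∷ n′ ∷ [])) (s≤s l))
    where open Blocks D
  ... | e-and-ab n n′ = 1+n≰n (≤-trans (count (_ ∷ _ ∷ []) bk ((e≉ab ∷ []) ∷ [] ∷ [])
          (there e∈ ∷ there ab ∷ []) (n ∷ n′ ∷ [])) (s≤s l))
    where open Blocks D
  ... | e-and-yv n n′ = 1+n≰n (≤-trans (count (_ ∷ _ ∷ []) bk ((e≉yv ∷ []) ∷ [] ∷ [])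
          (there e∈ ∷ there yv ∷ []) (n ∷ n′ ∷ [])) (s≤s l))
    where open Blocks D

  module _ {A B c x y v₁ v₂ v₃} (P : Position A B) (core : Book B c x y (v₁ ∷ v₂ ∷ v₃ ∷ [])) where

    A′ : List Triple
    A′ = reply P ∷ A

    frame-of : ∀ {S m κ p q U} → Book S κ p q U → Wasted A′ B κ p q U → Frame A′ (m ∷ B) κ p q
    frame-of {κ = κ} {p} {q} {U} b W = record
      { κ≢p = C≢X ; κ≢q = C≢Y ; p≢q = X≢Y
      ; class = λ i → [ (λ j → inj₁ (center {U = U} j , hub {U = U} j)) , inj₂ ]′ (class i)
      ; linear = linear ; κ∉o₁ = κ∉o₁
      ; κ∈o₂ = λ k → let p∉ , q∉ , z , w , e , blocked a b t = κ∈o₂ k in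
          z , w , e , (λ w≡p → p∉ (subst (_∈ᵛ o₂) w≡p (to e 3rd))) , (λ w≡q → q∉ (subst (_∈ᵛ o₂) w≡q (to e 3rd))) ,
          blocked a b ([ inj₁ ∘ there , inj₂ ∘ there ]′ t) }
      where
      open Wasted W
      open Book b using (C≢X; C≢Y; X≢Y)

    module _ (noCopy : ¬ Copy A′) {f} (f∉B : ¬ f ∈ₑ B) {κ p q u₁ u₂ u₃ u₄ : ℕ} where

      private
        U : List ℕ
        U = u₁ ∷ u₂ ∷ u₃ ∷ u₄ ∷ []

        take : ∀ {a b c} → a ≢ b → a ≢ c → b ≢ c → (a , b , c) ≈ f → ¬ f ∈ₑ A′ →
               Σ Triple λ m → Move P m × (a , b , c) ≈ m
        take a≢b a≢c b≢c f≈ f∉A = let m , m< , m≈ = edge a≢b a≢c b≢c in m , record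
          { noCopy = noCopy ; board = m<
          ; m∉A = λ i → f∉A (∈ₑ-resp (≈-trans (≈-sym m≈) f≈) i)
          ; m∉B = λ i → f∉B (∈ₑ-resp (≈-trans (≈-sym m≈) f≈) i) } , m≈

      respond-page : ∀ {p q u} → Book (f ∷ A′) κ p q U → Wasted A′ B κ p q U → u ∈ U → (κ , p , u) ≈ f → ¬ ¬ f ∈ₑ A′
      respond-page {p} {q} {u} b W u∈ f≈ f∉A
        with m , M , m≈ ← take (Book.C≢X b) (All.lookup (Book.C≢U b) u∈) (All.lookup (Book.X≢U b) u∈) f≈ f∉A
        with V , l , c ← others u∈ =
        pairing-draws (advance M) (record
          { frame = frame-of b W
          -- The exceptions are the three leaves other than u. Outside them P₁ can have an edge κpw
          -- or κqw only for w = u, and there κpu has just gone to P₂.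
          ; closed = inj₂ (V , ≤-reflexive (suc-injective l) , λ w w≢κ w≢p w≢q w∉V →
              (λ i → [ (λ { refl → ⊥-elim (f∉A (∈ₑ-resp f≈ i)) }) , ⊥-elim ∘ w∉V ]′ (c (leaf (inj₁ refl) w≢κ w≢p w≢q i))) ,
              (λ i → [ (λ { refl → here m≈ }) , ⊥-elim ∘ w∉V ]′ (c (leaf (inj₂ refl) w≢κ w≢p w≢q i)))) })
          (book-map there core)
        where
        open Wasted W
        leaf : ∀ {z w} → z ≡ p ⊎ z ≡ q → w ≢ κ → w ≢ p → w ≢ q → E A′ κ z w → w ∈ U
        leaf z≡ w≢κ w≢p w≢q i with class i
        ... | inj₂ (inj₁ e) = ⊥-elim (κ∉o₁ (to e 1st))
        ... | inj₂ (inj₂ e) = let p∉ , q∉ , _ = κ∈o₂ (to e 1st) in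
                ⊥-elim ([ (λ { refl → p∉ (to e 2nd) }) , (λ { refl → q∉ (to e 2nd) }) ]′ z≡)
        ... | inj₁ j with vertices {U = U} j 3rd
        ...   | here w≡κ = ⊥-elim (w≢κ w≡κ)
        ...   | there (here w≡p) = ⊥-elim (w≢p w≡p)
        ...   | there (there (here w≡q)) = ⊥-elim (w≢q w≡q)
        ...   | there (there (there w∈U)) = w∈U

      respond : Book (f ∷ A′) κ p q U → ¬ Wasted A′ B κ p q U
      respond b W with f ∈ₑ? A′
      ... | yes f∈A = noCopy (copy (book-map (λ { (here e) → ∈ₑ-resp (≈-sym e) f∈A ; (there i) → i }) b))
      ... | no f∉A with (κ , p , q) ≈? f
      ...   | yes f≈ with m , M , m≈ ← take (Book.C≢X b) (Book.C≢Y b) (Book.X≢Y b) f≈ f∉A =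
              pairing-draws (advance M) (record
                { frame = frame-of b W ; closed = inj₁ (here m≈) })
                (book-map there core)
      ...   | no f≉ with Any.any? (λ u → (κ , p , u) ≈? f) U | Any.any? (λ u → (κ , q , u) ≈? f) U
      ...     | yes i | _ = let u , u∈ , e = find i in respond-page b W u∈ e f∉A
      ...     | no _ | yes i = let u , u∈ , e = find i in respond-page (book-swap b) (wasted-swap W) u∈ e f∉A
      ...     | no ¬p | no ¬q = noCopy (copy (book (Book.distinct b) (old f≉ (Book.spine b))
                (All.tabulate λ i → old (λ e → ¬p (Any.map (λ { refl → e }) i)) (All.lookup (Book.pageX b) i))
                (All.tabulate λ i → old (λ e → ¬q (Any.map (λ { refl → e }) i)) (All.lookup (Book.pageY b) i))))
        where
        old : ∀ {t} → ¬ t ≈ f → t ∈ₑ f ∷ A′ → t ∈ₑ A′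
        old t≉f (here e) = ⊥-elim (t≉f e)
        old t≉f (there i) = i

    -- The two cores would need 7 + 4 edges.
    no-two-cores : length A ≤ 9 → CoreOn A′ c x → ¬ CoreOn A′ c y
    no-two-cores |A|≤9 (coreOn {C} {X} {Y} {U} pr l b) (coreOn {C′} {X′} {Y′} {U′} pr′ l′ b′) =
      1+n≰n {10} (≤-trans (+-mono-≤ (s≤s (+-mono-≤ l l)) (≤-trans (s≤s l′) (≤-reflexive (sym (length-map _ (Y′ ∷ U′))))))
        (≤-trans (count (map (λ w → c , y , w) (Y′ ∷ U′)) b (star-different second) rays∈ rays∉) (s≤s |A|≤9)))
      where
      open Book core using () renaming (C≢Y to c≢y; X≢Y to x≢y; spine to cxy)
      second : Star A′ c y (Y′ ∷ U′)
      second = [ (λ { (refl , refl) → Book.starX b′ }) , (λ { (refl , refl) → star-swap (Book.starX b′) }) ]′ pr′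
      rays∈ : All (_∈ₑ A′) (map (λ w → c , y , w) (Y′ ∷ U′))
      rays∈ = Allₚ.map⁺ (All.map proj₁ (Star.rays second))
      xy : ¬ E A′ C X y
      xy i = disjoint′ P ([ (λ { (refl , refl) → i }) , (λ { (refl , refl) → E₁₂ i }) ]′ pr) cxy
      y∉ : ¬ y ∈ C ∷ X ∷ Y ∷ U
      y∉ (here refl) = [ (λ { (e , _) → c≢y (sym e) }) , (λ { (e , _) → x≢y (sym e) }) ]′ pr
      y∉ (there (here refl)) = [ (λ { (_ , e) → x≢y (sym e) }) , (λ { (_ , e) → c≢y (sym e) }) ]′ pr
      y∉ (there (there (here refl))) = xy (Book.spine b)
      y∉ (there (there (there i))) = xy (All.lookup (Book.pageX b) i)
      rays∉ : All (λ o → ¬ o ∈ₑ bookEdges C X Y U) (map (λ w → c , y , w) (Y′ ∷ U′))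
      rays∉ = Allₚ.map⁺ (All.tabulate λ _ i → y∉ (vertices {U = U} i 2nd))

    settle : length A ≤ 9 → ¬ NoThreat A′ B
    settle |A|≤9 nt = chase P core nt λ { (k₁ , k₂) → no-two-cores |A|≤9 k₁ k₂ }

    live : ∀ {f} → ¬ f ∈ₑ B → Live (f ∷ A′) B
    live f∉B (here e) i = f∉B (∈ₑ-resp e i)
    live f∉B (there i) = disjoint′ P i

    module _ {f κ p q u₁ u₂ u₃ u₄} (b : Book (f ∷ A′) κ p q (u₁ ∷ u₂ ∷ u₃ ∷ u₄ ∷ [])) where

      private
        U : List ℕ
        U = u₁ ∷ u₂ ∷ u₃ ∷ u₄ ∷ []

      -- The nine edges of the threatened copy, the wasted `os` and one more edge outside it would
      -- all fit into `f ∷ A′`, which has at most 9 + |os| entries.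
      classify : ∀ os → Different os → All (_∈ₑ A′) os → All (λ o → ¬ o ∈ₑ bookEdges κ p q U) os →
                 length A′ ≤ 8 + length os → ∀ {t} → t ∈ₑ A′ → t ∈ₑ bookEdges κ p q U ⊎ t ∈ₑ os
      classify os os! os∈ os∉ l {t} t∈ with t ∈ₑ? bookEdges κ p q U | t ∈ₑ? os
      ... | yes i | _ = inj₁ i
      ... | _ | yes i = inj₂ i
      ... | no t∉ | no t∉os = ⊥-elim (1+n≰n (≤-trans
              (count (t ∷ os) b (All.tabulate (λ i e → t∉os (∈ₑ-resp (≈-sym e) (∈⇒∈ₑ i))) ∷ os!)
                (there t∈ ∷ All.map there os∈) (t∉ ∷ os∉)) (s≤s l)))

    end₇ : ¬ length A ≤ 7
    end₇ l = settle (≤-trans l (m≤n+m 7 2)) λ { {f} f∉B (copy {C} {X} {Y} {u₁} {u₂} {u₃} {u₄} b) → respond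
      (λ { (copy b′) → 1+n≰n (≤-trans (count [] b′ [] [] []) (s≤s l)) }) f∉B b (record
        -- There is no wasted edge, so a degenerate triple off the centre fills both slots.
        { o₁ = suc C , suc C , suc C ; o₂ = suc C , suc C , suc C
        ; class = λ i → [ inj₁ , (λ ()) ]′ (classify b [] [] [] [] (s≤s l) i)
        ; linear = λ _ _ _ _ _ → ≈-refl
        ; κ∉o₁ = junk ; κ∈o₂ = λ k → ⊥-elim (junk k) }) }
      where
      junk : ∀ {C} → ¬ C ∈ᵛ (suc C , suc C , suc C)
      junk (inj₁ ())
      junk (inj₂ (inj₁ ()))
      junk (inj₂ (inj₂ ()))

    -- All edges of a copy of G share the centre, so one of two disjoint edges is wasted, and it avoids the centre if the
    -- other is not.
    module _ {e d} (e∈ : e ∈ₑ A) (d∈ : d ∈ₑ A) (e∩d : ∀ {v} → v ∈ᵛ e → ¬ v ∈ᵛ d) where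

      private
        spare : ∀ {S C X Y U} → Book S C X Y U →
                Σ Triple λ o → o ∈ₑ A × ¬ o ∈ₑ bookEdges C X Y U × (o ≡ e × (d ∈ₑ bookEdges C X Y U → ¬ C ∈ᵛ o) ⊎ ¬ C ∈ᵛ o)
        spare {C = C} {X} {Y} {U} b with e ∈ₑ? bookEdges C X Y U
        ... | yes i = d , d∈ , (λ j → e∩d (center {U = U} i) (center {U = U} j)) , inj₂ (e∩d (center {U = U} i))
        ... | no e∉ = e , e∈ , e∉ , inj₁ (refl , λ j k → e∩d k (center {U = U} j))

      end₈ : ¬ length A ≤ 8
      end₈ l = settle (≤-trans l (m≤n+m 8 1)) λ { {f} f∉B (copy {C} {X} {Y} {u₁} {u₂} {u₃} {u₄} b) → threat f∉B b (spare b) }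
        where
        noCopy : ¬ Copy A′
        noCopy (copy b) = let o , o∈ , o∉ , _ = spare b in
          1+n≰n (≤-trans (count [ o ] b ([] ∷ []) (there o∈ ∷ []) (o∉ ∷ [])) (s≤s l))
        threat : ∀ {f C X Y u₁ u₂ u₃ u₄} → let U = u₁ ∷ u₂ ∷ u₃ ∷ u₄ ∷ [] in ¬ f ∈ₑ B → (b : Book (f ∷ A′) C X Y U) →
                 (Σ Triple λ o → o ∈ₑ A × ¬ o ∈ₑ bookEdges C X Y U × (o ≡ e × (d ∈ₑ bookEdges C X Y U → ¬ C ∈ᵛ o) ⊎ ¬ C ∈ᵛ o)) → ⊥
        threat {C = C} f∉B b (o , o∈ , o∉ , C∉) = respond noCopy f∉B b (record
          { o₁ = o ; o₂ = o
          ; class = λ i → [ inj₁ , (λ { (here e) → inj₂ (inj₁ e) }) ]′ (cls i)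
          ; linear = λ _ _ _ _ _ → ≈-refl
          ; κ∉o₁ = C∉o C∉ ; κ∈o₂ = λ k → ⊥-elim (C∉o C∉ k) })
          where
          cls = classify b [ o ] ([] ∷ []) (there o∈ ∷ []) (o∉ ∷ []) (s≤s l)
          C∉o : _ → ¬ C ∈ᵛ o
          C∉o (inj₂ n) = n
          -- The count allows one wasted edge only. If it is e, then d lies in the copy, and the
          -- centre is in d and not in e.
          C∉o (inj₁ (refl , n)) = n ([ id , (λ { (here q) → ⊥-elim (e∩d (to q 1st) 1st) }) ]′ (cls (there d∈)))

    -- With e and gab wasted the count puts gyv into the copy. So the centre avoids e, and some
    -- spine vertex lies in gyv; by symmetry it is p. The wasted gab may still contain the centre,
    -- which is the case that `κ∈o₂` in `Wasted` provides for.
    one-block : ∀ {e g a b y v} → Blocks A B e g a b y v → length A ≤ 9 → ¬ Copy A′ →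
                ∀ {f κ p q u₁ u₂ u₃ u₄} → let U = u₁ ∷ u₂ ∷ u₃ ∷ u₄ ∷ [] in ¬ f ∈ₑ B → Book (f ∷ A′) κ p q U →
                ¬ e ∈ₑ bookEdges κ p q U → ¬ ¬ (g , a , b) ∈ₑ bookEdges κ p q U
    one-block {e} {g} {a} {b} {y} {v} D l noCopy {f} {κ} {p} {q} {u₁} {u₂} {u₃} {u₄} f∉B bk e∉ ab∉ =
      [ go bk e∉ ab∉ , go (book-swap bk) (e∉ ∘ bookEdges-swap U) (ab∉ ∘ bookEdges-swap U) ]′ (hub {U = U} (yv∈ bk e∉ ab∉))
      where
      open Blocks D
      U = u₁ ∷ u₂ ∷ u₃ ∷ u₄ ∷ []
      module _ {p q} (bk : Book (f ∷ A′) κ p q U) (e∉ : ¬ e ∈ₑ bookEdges κ p q U)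
               (ab∉ : ¬ (g , a , b) ∈ₑ bookEdges κ p q U) where
        class : ∀ {t} → t ∈ₑ A′ → t ∈ₑ bookEdges κ p q U ⊎ t ≈ e ⊎ t ≈ (g , a , b)
        class i = [ inj₁ , (λ { (here p) → inj₂ (inj₁ p) ; (there (here p)) → inj₂ (inj₂ p) }) ]′
          (classify bk (e ∷ (g , a , b) ∷ []) ((e≉ab ∷ []) ∷ [] ∷ [])
            (there e∈ ∷ there ab ∷ []) (e∉ ∷ ab∉ ∷ []) (s≤s l) i)
        yv∈ : (g , y , v) ∈ₑ bookEdges κ p q U
        yv∈ with class (there yv)
        ... | inj₁ i = i
        ... | inj₂ (inj₁ r) = ⊥-elim (e≉yv (≈-sym r))
        ... | inj₂ (inj₂ r) = ⊥-elim (ab≉yv (≈-sym r))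
        go : ¬ p ∈ᵛ (g , y , v)
        go p∈ = respond noCopy f∉B bk (record
          { o₁ = e ; o₂ = g , a , b ; class = class
          ; linear = λ _ w∈ _ w∈′ _ → ⊥-elim (e∌ab w∈′ w∈)
          ; κ∉o₁ = e∌yv (center {U = U} yv∈)
          ; κ∈o₂ = λ k → odd (centre≡g k (center {U = U} yv∈)) })
          where
          open Book bk
          odd : κ ≡ g → ¬ p ∈ᵛ (g , a , b) × ¬ q ∈ᵛ (g , a , b) ×
                Σ ℕ λ z → Σ ℕ λ w → (κ , z , w) ≈ (g , a , b) × Blocked A′ B κ p q w
          -- Now p is y or v. The blocked vertex is a because P₂ owns both gya and gav, hence gpa in
          -- either case.
          odd refl = p∉ , q∉ p∈ , b , a , swap₂₃ , blocked
              (λ i → disjoint′ P i (pa p∈)) qa (inj₁ (pa p∈))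
            where
            pa : p ∈ᵛ (g , y , v) → E B g p a
            pa 1st = ⊥-elim (C≢X refl)
            pa 2nd = ya
            pa 3rd = E₂₃ av
            p∉ : ¬ p ∈ᵛ (g , a , b)
            p∉ k = C≢X (sym (centre≡g k p∈))
            a-off : ¬ a ∈ g ∷ p ∷ q ∷ U
            a-off = off-book (live f∉B) bk (pa p∈) (≢-sym g≢a) (λ { refl → p∉ 2nd })
            q∉ : p ∈ᵛ (g , y , v) → ¬ q ∈ᵛ (g , a , b)
            q∉ _ 1st = C≢Y refl
            q∉ _ 2nd = a-off (there (there (here refl)))
            q∉ 1st 3rd = C≢X refl
            q∉ 2nd 3rd = live f∉B spine yb
            q∉ 3rd 3rd = off-book (live f∉B) (book-swap bk) (E₂₃ yb) (≢-sym g≢y) (≢-sym b≢y)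
                           (vertices {U = U} (bookEdges-swap U yv∈) 2nd)
            qa : ¬ E A′ g q a
            qa i with class i
            ... | inj₁ j = a-off (vertices {U = U} j 3rd)
            ... | inj₂ (inj₁ r) = e∌ab 1st (to r 1st)
            ... | inj₂ (inj₂ r) = q∉ p∈ (to r 2nd)

    end₉ : ∀ {e g a b y v} → Blocks A B e g a b y v → ¬ length A ≤ 9
    end₉ {e} {g} {a} {b} {y} {v} D l = settle l λ { f∉B (copy bk) → threat f∉B bk }
      where
      open Blocks D
      noCopy : ¬ Copy A′
      noCopy = blocks-noCopy P D l
      threat : ∀ {f κ p q u₁ u₂ u₃ u₄} → ¬ f ∈ₑ B → ¬ Book (f ∷ A′) κ p q (u₁ ∷ u₂ ∷ u₃ ∷ u₄ ∷ [])
      threat {u₁ = u₁} {u₂} {u₃} {u₄} f∉B bk with spares D (live f∉B) bk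
      ... | e-and-ab n n′ = one-block D l noCopy f∉B bk n n′
      ... | e-and-yv n n′ = one-block (blocks-swap D) l noCopy f∉B bk n n′
      ... | both-blocks i n n′ = respond noCopy f∉B bk (record
        { o₁ = g , a , b ; o₂ = g , y , v
        ; class = λ j → [ inj₁ , (λ { (here p) → inj₂ (inj₁ p) ; (there (here p)) → inj₂ (inj₂ p) }) ]′
            (classify bk ((g , a , b) ∷ (g , y , v) ∷ []) ((ab≉yv ∷ []) ∷ [] ∷ [])
              (there ab ∷ there yv ∷ []) (n ∷ n′ ∷ []) (s≤s l) j)
        ; linear = λ w≢w′ w∈ w′∈ w∈′ w′∈′ → ⊥-elim (w≢w′ (trans (centre≡g w∈ w∈′) (sym (centre≡g w′∈ w′∈′))))
        ; κ∉o₁ = λ k → e∌ab k κ∈e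
        ; κ∈o₂ = λ k → ⊥-elim (e∌yv k κ∈e) })
        where κ∈e = center {U = u₁ ∷ u₂ ∷ u₃ ∷ u₄ ∷ []} i

-- Opening

∉₃ : ∀ {w a b c} → w ≢ a → w ≢ b → w ≢ c → ¬ w ∈ᵛ (a , b , c)
∉₃ p q r 1st = p refl
∉₃ p q r 2nd = q refl
∉₃ p q r 3rd = r refl

≉-by₂ : ∀ {a b c t u} → t ≈ u → ¬ b ∈ᵛ t → ¬ (a , b , c) ≈ u
≉-by₂ t≈u b∉ p = b∉ (from t≈u (to p 2nd))

-- The i-th move of P₂ is mᵢ and the answer of P₁ to it is rᵢ.
module Opening (σ₁ : Strategy) (wins : P₁Wins σ₁) where
  open Game σ₁
  open Position
  open Ending σ₁

  e : Triple
  e = σ₁ []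

  put : ∀ {A B a b c} (P : Position A B) → ¬ Copy (reply P ∷ A) → a ≢ b → a ≢ c → b ≢ c →
        ¬ E (reply P ∷ A) a b c → ¬ E B a b c → Σ Triple λ m → (a , b , c) ≈ m × Position (reply P ∷ A) (m ∷ B)
  put P nc a≢b a≢c b≢c ∉A ∉B = let m , m< , m≈ = edge a≢b a≢c b≢c in m , m≈ , advance {P = P} (record
    { noCopy = nc ; board = m<
    ; m∉A = ∉A ∘ ∈ₑ-resp (≈-sym m≈) ; m∉B = ∉B ∘ ∈ₑ-resp (≈-sym m≈) })

  few : ∀ {A} {r : Triple} → length A ≤ 7 → ¬ Copy (r ∷ A)
  few l (copy b) = 1+n≰n (≤-trans (count [] b [] [] []) (s≤s l))

  record Stage (n : ℕ) (A B : List Triple) (c x y : ℕ) (U : List ℕ) : Set where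
    field
      pos   : Position A B
      size  : length A ≤ n
      e∈    : e ∈ₑ A
      built : Book B c x y U
      e∌    : ∀ {w} → w ∈ c ∷ x ∷ y ∷ U → ¬ w ∈ᵛ e

  module Late {A B c x y a b} (D : Stage 5 A B c x y (a ∷ b ∷ [])) where
    open Stage D
    open Book built renaming (C≢X to c≢x; C≢Y to c≢y; X≢Y to x≢y)

    c≢a : c ≢ a
    c≢a = All.lookup C≢U (here refl)
    c≢b : c ≢ b
    c≢b = All.lookup C≢U (there (here refl))
    x≢a : x ≢ a
    x≢a = All.lookup X≢U (here refl)
    x≢b : x ≢ b
    x≢b = All.lookup X≢U (there (here refl))
    y≢a : y ≢ a
    y≢a = All.lookup Y≢U (here refl)
    y≢b : y ≢ b
    y≢b = All.lookup Y≢U (there (here refl))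
    a≢b : a ≢ b
    a≢b with (p ∷ []) ∷ _ ← U! = p
    cxa : E B c x a
    cxa = All.lookup pageX (here refl)
    cxb : E B c x b
    cxb = All.lookup pageX (there (here refl))
    cya : E B c y a
    cya = All.lookup pageY (here refl)
    cyb : E B c y b
    cyb = All.lookup pageY (there (here refl))

    A₅ : List Triple
    A₅ = reply pos ∷ A

    v : ℕ
    v = proj₁ (fresh A₅ B)
    vA : Free v A₅
    vA = proj₁ (proj₂ (fresh A₅ B))
    vB : Free v B
    vB = proj₂ (proj₂ (fresh A₅ B))
    v∉ : ¬ v ∈ c ∷ x ∷ y ∷ a ∷ b ∷ []
    v∉ = free-book vB built
    c≢v : c ≢ v
    c≢v p = v∉ (here (sym p))
    x≢v : x ≢ v
    x≢v p = v∉ (there (here (sym p)))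
    y≢v : y ≢ v
    y≢v p = v∉ (there (there (here (sym p))))
    a≢v : a ≢ v
    a≢v p = v∉ (there (there (there (here (sym p)))))
    b≢v : b ≢ v
    b≢v p = v∉ (there (there (there (there (here (sym p))))))
    e∌v : ¬ v ∈ᵛ e
    e∌v = vA (there e∈)

    -- The pairs xy, xa, ya form a triangle in P₂'s link of c, so a can replace y on the spine.
    bookOnXA : Book B c x a (y ∷ [])
    bookOnXA = book ((c≢x ∷ c≢a ∷ c≢y ∷ []) ∷ (x≢a ∷ x≢y ∷ []) ∷ (≢-sym y≢a ∷ []) ∷ [] ∷ [])
                 cxa (spine ∷ []) (E₂₃ cya ∷ [])

    -- After cab the vertices x, y, a, b are pairwise joined in P₂'s link of c, and v is joined to
    -- x. The edge cav would give the spine cxa the pages y, b, v: a core in eight moves, paid for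
    -- by the block cyv.
    complete-cav : ∀ {m₆ r₆ m₇} → (c , x , v) ≈ m₆ → (c , y , v) ≈ r₆ → (c , a , b) ≈ m₇ →
                   (P : Position (r₆ ∷ A₅) (m₇ ∷ m₆ ∷ B)) → ¬ ¬ (c , a , v) ≈ reply P
    complete-cav m₆≈ r₆≈ m₇≈ P r≉
      with put P (few (s≤s (s≤s size))) c≢a c≢v a≢v
        (λ { (here p) → r≉ p
           ; (there (here p)) → ≉-by₂ r₆≈ (∉₃ (≢-sym c≢a) (≢-sym y≢a) a≢v) p
           ; (there (there i)) → vA i 3rd })
        (λ { (here p) → ∉₃ (≢-sym c≢v) (≢-sym a≢v) (≢-sym b≢v) (from m₇≈ (to p 3rd))
           ; (there (here p)) → ≉-by₂ m₆≈ (∉₃ (≢-sym c≢a) (≢-sym x≢a) a≢v) p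
           ; (there (there i)) → vB i 3rd })
    ... | m₈ , m₈≈ , P₈ = end₈ P₈
      (book-∷ v∉′ (there (there (here m₆≈))) (here m₈≈)
        (book-∷ b∉′ (there (there (there cxb))) (there (here m₇≈)) (book-map (there ∘ there ∘ there) bookOnXA)))
      (there (there (there e∈))) (there (here r₆≈)) e∩d (s≤s (s≤s (s≤s size)))
      where
      b∉′ : ¬ b ∈ c ∷ x ∷ a ∷ y ∷ []
      b∉′ = λ { (here p) → c≢b (sym p) ; (there (here p)) → x≢b (sym p) ; (there (there (here p))) → a≢b (sym p)
              ; (there (there (there (here p)))) → y≢b (sym p) }
      v∉′ : ¬ v ∈ c ∷ x ∷ a ∷ b ∷ y ∷ []
      v∉′ = λ { (here p) → c≢v (sym p) ; (there (here p)) → x≢v (sym p) ; (there (there (here p))) → a≢v (sym p)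
              ; (there (there (there (here p)))) → b≢v (sym p) ; (there (there (there (there (here p))))) → y≢v (sym p) }
      e∩d : ∀ {w} → w ∈ᵛ e → ¬ w ∈ᵛ (c , y , v)
      e∩d w∈ 1st = e∌ (here refl) w∈
      e∩d w∈ 2nd = e∌ (there (there (here refl))) w∈
      e∩d w∈ 3rd = e∌v w∈

    blocks : ∀ {A″ B″} → (∀ {t} → t ∈ₑ A₅ → t ∈ₑ A″) → (∀ {t} → t ∈ₑ B → t ∈ₑ B″) →
             E A₅ c a b → E A″ c y v → E B″ c a v → Blocks A″ B″ e c a b y v
    blocks inA inB ab∈ yv∈ av∈ = record
      { g≢a = c≢a ; g≢y = c≢y ; a≢y = ≢-sym y≢a ; a≢v = a≢v ; b≢y = ≢-sym y≢b ; b≢v = b≢v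
      ; ab = inA ab∈ ; yv = yv∈ ; ya = inB cya ; yb = inB cyb ; av = av∈ ; e∈ = inA (there e∈)
      ; e∌ab = λ { 1st → e∌ (here refl) ; 2nd → e∌ (there (there (there (here refl))))
                 ; 3rd → e∌ (there (there (there (there (here refl))))) }
      ; e∌yv = λ { 1st → e∌ (here refl) ; 2nd → e∌ (there (there (here refl))) ; 3rd → e∌v } }

    -- With cab taken by P₁, the spine cxy has pages a, b and, after cav, the spine cxa has pages y,
    -- v. The move cxw with w new prepares a third page for both, by cyw or caw, and one reply
    -- cannot stop both. The ninth move is paid for by the blocks cab and cyv.
    blocked-twice : ∀ {m₆ r₆ m₇} → (c , x , v) ≈ m₆ → (c , y , v) ≈ r₆ → (c , a , v) ≈ m₇ → E A₅ c a b →
                    ¬ Position (r₆ ∷ A₅) (m₇ ∷ m₆ ∷ B)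
    blocked-twice {m₆} {r₆} {m₇} m₆≈ r₆≈ m₇≈ ab∈ P
      with w , wA , wB ← fresh (reply P ∷ r₆ ∷ A₅) (m₇ ∷ m₆ ∷ B)
      with w∉ ← free-book wB (book-map (there ∘ there) built)
      with w≢v ← ≢-sym (free-≢ wB (here m₇≈) 3rd)
      with m₈ , m₈≈ , P₈ ← put P (few (s≤s (s≤s size))) c≢x (w∉ ∘ here ∘ sym) (w∉ ∘ there ∘ here ∘ sym)
                             (λ i → wA i 3rd) (λ i → wB i 3rd)
      with D₈ ← blocks {reply P ∷ r₆ ∷ A₅} {m₈ ∷ m₇ ∷ m₆ ∷ B} (there ∘ there) (there ∘ there ∘ there) ab∈
                  (there (here r₆≈)) (there (here m₇≈))
      with (c , y , w) ≈? reply P₈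
    ... | no r≉
      with m₉ , m₉≈ , P₉ ← put P₈ (blocks-noCopy P₈ D₈ (≤-trans (s≤s (s≤s (s≤s size))) (n≤1+n 8)))
             c≢y (w∉ ∘ here ∘ sym) (w∉ ∘ there ∘ there ∘ here ∘ sym)
             (λ { (here p) → r≉ p ; (there i) → wA i 3rd })
             (λ { (here p) → ≉-by₂ m₈≈ (∉₃ (≢-sym c≢y) (≢-sym x≢y) (w∉ ∘ there ∘ there ∘ here ∘ sym)) p
                ; (there i) → wB i 3rd }) =
      end₉ P₉ (book-∷ w∉ (there (here m₈≈)) (here m₉≈) (book-map (there ∘ there ∘ there ∘ there) built))
        (blocks (there ∘ there ∘ there) (there ∘ there ∘ there ∘ there) ab∈ (there (there (here r₆≈))) (there (there (here m₇≈))))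
        (s≤s (s≤s (s≤s (s≤s size))))
    ... | yes r≈
      with m₉ , m₉≈ , P₉ ← put P₈ (blocks-noCopy P₈ D₈ (≤-trans (s≤s (s≤s (s≤s size))) (n≤1+n 8)))
             c≢a (w∉ ∘ here ∘ sym) (w∉ ∘ there ∘ there ∘ there ∘ here ∘ sym)
             (λ { (here p) → ≉-by₂ r≈ (∉₃ (≢-sym c≢a) (≢-sym y≢a) (w∉ ∘ there ∘ there ∘ there ∘ here ∘ sym)) p
                ; (there i) → wA i 3rd })
             (λ { (here p) → ≉-by₂ m₈≈ (∉₃ (≢-sym c≢a) (≢-sym x≢a) (w∉ ∘ there ∘ there ∘ there ∘ here ∘ sym)) p
                ; (there i) → wB i 3rd }) =
      end₉ P₉
        (book-∷ (λ { (here p) → w∉ (here p) ; (there (here p)) → w∉ (there (here p))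
                   ; (there (there (here p))) → w∉ (there (there (there (here p)))) ; (there (there (there (here p)))) → w≢v p
                   ; (there (there (there (there (here p))))) → w∉ (there (there (here p))) })
          (there (here m₈≈)) (here m₉≈)
          (book-∷ (λ { (here p) → v∉ (here p) ; (there (here p)) → v∉ (there (here p))
                     ; (there (there (here p))) → a≢v (sym p) ; (there (there (there (here p)))) → y≢v (sym p) })
            (there (there (there (here m₆≈)))) (there (there (here m₇≈)))
            (book-map (there ∘ there ∘ there ∘ there) bookOnXA)))
        (blocks (there ∘ there ∘ there) (there ∘ there ∘ there ∘ there) ab∈ (there (there (here r₆≈))) (there (there (here m₇≈))))
        (s≤s (s≤s (s≤s (s≤s size))))

  stage-swap : ∀ {n A B c x y a b} → Stage n A B c x y (a ∷ b ∷ []) → Stage n A B c x y (b ∷ a ∷ [])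
  stage-swap D = record
    { pos = pos ; size = size ; e∈ = e∈
    ; built = book-sub exchange ((≢-sym (All.head (AllPairs.head (Book.U! built))) ∷ []) ∷ [] ∷ []) built
    ; e∌ = λ { (here p) → e∌ (here p) ; (there (here p)) → e∌ (there (here p))
             ; (there (there (here p))) → e∌ (there (there (here p)))
             ; (there (there (there i))) → e∌ (there (there (there (exchange i)))) } }
    where
    open Stage D
    exchange : ∀ {a b w : ℕ} → w ∈ b ∷ a ∷ [] → w ∈ a ∷ b ∷ []
    exchange (here p) = there (here p)
    exchange (there (here p)) = here p

  module _ {A B c x y a b} (D : Stage 5 A B c x y (a ∷ b ∷ [])) (ab∉B : ¬ E B c a b) where
    open Late D
    open Stage D
    open Book built renaming (C≢X to c≢x; C≢Y to c≢y; X≢Y to x≢y)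

    two-pages : ⊥
    two-pages with m₆ , m₆≈ , P ← put pos (few (≤-trans size (m≤n+m 5 2))) c≢x c≢v x≢v (λ i → vA i 3rd) (λ i → vB i 3rd)
      with (c , y , v) ≈? reply P
    ... | no r≉ with m₇ , m₇≈ , P₇ ← put P (few (≤-trans (s≤s size) (n≤1+n 6))) c≢y c≢v y≢v
            (λ { (here p) → r≉ p ; (there i) → vA i 3rd })
            (λ { (here p) → ≉-by₂ m₆≈ (∉₃ (≢-sym c≢y) (≢-sym x≢y) y≢v) p ; (there i) → vB i 3rd }) =
      end₇ P₇ (book-∷ v∉ (there (here m₆≈)) (here m₇≈) (book-map (there ∘ there) built)) (s≤s (s≤s size))
    ... | yes r≈ with (c , a , b) ∈ₑ? A₅
    ...   | yes ab∈ with m₇ , m₇≈ , P₇ ← put P (few (≤-trans (s≤s size) (n≤1+n 6))) c≢a c≢v a≢v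
            (λ { (here p) → ≉-by₂ r≈ (∉₃ (≢-sym c≢a) (≢-sym y≢a) a≢v) p ; (there i) → vA i 3rd })
            (λ { (here p) → ≉-by₂ m₆≈ (∉₃ (≢-sym c≢a) (≢-sym x≢a) a≢v) p ; (there i) → vB i 3rd }) =
      blocked-twice m₆≈ r≈ m₇≈ ab∈ P₇
    ...   | no ab∉ with m₇ , m₇≈ , P₇ ← put P (few (≤-trans (s≤s size) (n≤1+n 6))) c≢a c≢b a≢b
            (λ { (here p) → ≉-by₂ r≈ (∉₃ (≢-sym c≢a) (≢-sym y≢a) a≢v) p ; (there i) → ab∉ i })
            (λ { (here p) → ≉-by₂ m₆≈ (∉₃ (≢-sym c≢a) (≢-sym x≢a) a≢v) p ; (there i) → ab∉B i }) =
      -- Exchanging a and b, P₂ also completes a core by cbv; a single reply cannot be both cav and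
      -- cbv.
      complete-cav m₆≈ r≈ m₇≈ P₇ λ p →
        Late.complete-cav (stage-swap D) m₆≈ r≈ (≈-trans swap₂₃ m₇≈) P₇ λ q →
          ≉-by₂ p (∉₃ (≢-sym c≢b) (≢-sym a≢b) b≢v) q

  -- In P₂'s link of c the vertices x, s, t form a triangle. After cxv either csv or ctv gives two
  -- pages, on the spine cxs or cxt, and P₁ can take only one of them.
  one-page : ∀ {A B c x s t} → ¬ Stage 3 A B c x s (t ∷ [])
  one-page {A} {B} {c} {x} {s} {t} T
    with v , vA , vB ← fresh (reply (Stage.pos T) ∷ A) B
    with v∉ ← free-book vB (Stage.built T)
    with m₄ , m₄≈ , P ← put (Stage.pos T) (few (≤-trans (Stage.size T) (m≤n+m 3 4)))
           (Book.C≢X (Stage.built T)) (v∉ ∘ here ∘ sym) (v∉ ∘ there ∘ here ∘ sym) (λ i → vA i 3rd) (λ i → vB i 3rd)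
    = cases ((c , s , v) ≈? reply P)
    where
    open Stage T
    open Book built
    c≢v : c ≢ v
    c≢v = v∉ ∘ here ∘ sym
    x≢v : x ≢ v
    x≢v = v∉ ∘ there ∘ here ∘ sym
    second-page : ∀ {y a} → Book B c x y (a ∷ []) → (∀ {w} → w ∈ c ∷ x ∷ y ∷ a ∷ [] → w ∈ c ∷ x ∷ s ∷ t ∷ []) →
                  ¬ ¬ (c , y , v) ≈ reply P
    second-page {y} {a} bk sub r≉
      with y≢v ← v∉ ∘ sub ∘ there ∘ there ∘ here ∘ sym
      with m₅ , m₅≈ , P₅ ← put P (few (≤-trans (s≤s size) (m≤n+m 4 3))) (Book.C≢Y bk) c≢v y≢v
             (λ { (here p) → r≉ p ; (there i) → vA i 3rd })
             (λ { (here p) → ≉-by₂ m₄≈ (∉₃ (≢-sym (Book.C≢Y bk)) (≢-sym (Book.X≢Y bk)) y≢v) p ; (there i) → vB i 3rd })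
      = two-pages (record
          { pos = P₅ ; size = s≤s (s≤s size) ; e∈ = there (there e∈)
          ; built = book-∷ (v∉ ∘ sub) (there (here m₄≈)) (here m₅≈) (book-map (there ∘ there) bk)
          ; e∌ = λ { (here p) → e∌ (sub (here p)) ; (there (here p)) → e∌ (sub (there (here p)))
                   ; (there (there (here p))) → e∌ (sub (there (there (here p))))
                   ; (there (there (there (here refl)))) → vA (there e∈)
                   ; (there (there (there (there i)))) → e∌ (sub (there (there (there i)))) } })
          (λ { (here p) → ∉₃ (≢-sym c≢a) (≢-sym y≢a) a≢v (from m₅≈ (to p 3rd))
             ; (there (here p)) → ∉₃ (≢-sym c≢a) (≢-sym x≢a) a≢v (from m₄≈ (to p 3rd))
             ; (there (there i)) → vB i 2nd })
      where
      a≢v : a ≢ v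
      a≢v = v∉ ∘ sub ∘ there ∘ there ∘ there ∘ here ∘ sym
      c≢a = All.head (Book.C≢U bk)
      x≢a = All.head (Book.X≢U bk)
      y≢a = All.head (Book.Y≢U bk)
    cases : Dec ((c , s , v) ≈ reply P) → ⊥
    cases (no r≉) = second-page built id r≉
    cases (yes r≈) = second-page
      (book ((C≢X ∷ All.head C≢U ∷ C≢Y ∷ []) ∷ (All.head X≢U ∷ X≢Y ∷ []) ∷ (≢-sym (All.head Y≢U) ∷ []) ∷ [] ∷ [])
        (All.head pageX) (spine ∷ []) (E₂₃ (All.head pageY) ∷ []))
      (λ { (here p) → here p ; (there (here p)) → there (here p)
         ; (there (there (here p))) → there (there (there (here p)))
         ; (there (there (there (here p)))) → there (there (here p)) })
      (≉-by₂ r≈ (∉₃ (≢-sym (All.head C≢U)) (≢-sym (All.head Y≢U)) (v∉ ∘ there ∘ there ∘ there ∘ here ∘ sym)))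

  private
    -- The first three vertices beyond e, so that the book starts off her first edge.
    a = bound (e ∷ [])
    b = suc a
    s = suc b
    a≢b : a ≢ b
    a≢b = <⇒≢ (n<1+n a)
    b≢s : b ≢ s
    b≢s = <⇒≢ (n<1+n b)
    a≢s : a ≢ s
    a≢s = <⇒≢ (m<n⇒m<1+n (n<1+n a))
    aF : Free a (e ∷ [])
    aF = free-≥bound ≤-refl
    bF : Free b (e ∷ [])
    bF = free-≥bound (n≤1+n a)
    sF : Free s (e ∷ [])
    sF = free-≥bound (m≤n+m a 2)

  contradiction : ⊥
  contradiction
    with m₁ , m₁≈ , P₁ ← put (initial wins) (few z≤n) a≢b a≢s b≢s (λ i → aF i 1st) (λ ())
    with t , tA , tB ← fresh (reply P₁ ∷ e ∷ []) (m₁ ∷ [])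
    with m₂ , m₂≈ , P₂ ← put P₁ (few (s≤s z≤n)) a≢b (free-≢ tB (here m₁≈) 1st) (free-≢ tB (here m₁≈) 2nd)
                           (λ i → tA i 3rd) (λ i → tB i 3rd)
    = cases ((a , s , t) ≈? reply P₂)
    where
    a≢t : a ≢ t
    a≢t = free-≢ tB (here m₁≈) 1st
    b≢t : b ≢ t
    b≢t = free-≢ tB (here m₁≈) 2nd
    s≢t : s ≢ t
    s≢t = free-≢ tB (here m₁≈) 3rd
    e∋ : e ∈ₑ e ∷ []
    e∋ = here ≈-refl
    -- After abs and abt both a and b can be the centre, and r₂ spoils only one of them.
    first-page : ∀ {c x} → c ≢ x → c ≢ s → x ≢ s → c ≢ t → x ≢ t → E (m₁ ∷ []) c x s → (c , x , t) ≈ m₂ →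
                 ¬ c ∈ᵛ e → ¬ x ∈ᵛ e → ¬ ¬ (c , s , t) ≈ reply P₂
    first-page {c} {x} c≢x c≢s x≢s c≢t x≢t cxs cxt c∉e x∉e r≉
      with m₃ , m₃≈ , P₃ ← put P₂ (few (m≤n+m 2 5)) c≢s c≢t s≢t
             (λ { (here p) → r≉ p ; (there i) → tA i 3rd })
             (λ { (here p) → ≉-by₂ cxt (∉₃ (≢-sym c≢s) (≢-sym x≢s) s≢t) p ; (there i) → tB i 3rd })
      = one-page (record
          { pos = P₃ ; size = ≤-refl ; e∈ = there (there e∋)
          ; built = book ((c≢x ∷ c≢s ∷ c≢t ∷ []) ∷ (x≢s ∷ x≢t ∷ []) ∷ (s≢t ∷ []) ∷ [] ∷ [])
              (there (there cxs)) (there (here cxt) ∷ []) (here m₃≈ ∷ [])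
          ; e∌ = λ { (here refl) → c∉e ; (there (here refl)) → x∉e ; (there (there (here refl))) → sF e∋
                   ; (there (there (there (here refl)))) → tA (there e∋) } })
    cases : Dec ((a , s , t) ≈ reply P₂) → ⊥
    cases (no r≉) = first-page a≢b a≢s b≢s a≢t b≢t (here m₁≈) m₂≈ (aF e∋) (bF e∋) r≉
    cases (yes r≈) = first-page (≢-sym a≢b) b≢s a≢s b≢t a≢t (E₁₂ (here m₁≈)) (≈-trans swap₁₂ m₂≈) (bF e∋) (aF e∋)
      (λ p → ∉₃ (≢-sym a≢b) b≢s b≢t (from r≈ (to p 1st)))

theorem3p1 : ¬ (Σ Strategy P₁Wins)
theorem3p1 (σ₁ , wins) = Opening.contradiction σ₁ wins
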